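{- Let $k\ge 2$ and let $T$ be a forest with $h$ vertices. If $k=2$ or if $T$ is a tree, then there exists a constant $C=C(k,h)$ such that for all sufficiently large $n$, $$\big|\,\mathrm{nim}_k(n;T)-(k-1)\,\mathrm{ex}(n,T)\,\big|\le C(k,h).$$
   Context: For a $k$-edge-colouring of $K_n$, an edge is a NIM-edge if it is not contained in any copy of $T$ all of whose edges have the same colour; $\mathrm{nim}_k(n;T)$ is the maximum number of NIM-edges over all $k$-edge-colourings of $K_n$. $\mathrm{ex}(n,T)$ is the maximum number of edges of a $T$-free graph on $n$ vertices. -}

module Defs where

open import Data.Nat using (ℕ; zero; suc; _+_; _*_; _∸_; _≤_; _<_)
open import Data.Fin using (Fin; toℕ)
open import Data.Bool using (Bool; true; false)
open import Data.Product using (Σ; ∃; _×_; _,_)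
open import Data.Sum using (_⊎_)
open import Data.Empty using (⊥)
open import Data.List using (List; []; _∷_; length)
open import Data.List.Membership.Propositional using (_∈_)
open import Data.List.Relation.Unary.All using (All)
open import Data.List.Relation.Unary.Unique.Propositional using (Unique)
open import Relation.Nullary using (¬_)
open import Relation.Binary.PropositionalEquality using (_≡_; _≢_)
open import Function.Definitions using (Injective)

record Graph (n : ℕ) : Set where
  field
    adj   : Fin n → Fin n → Bool
    sym   : ∀ i j → adj i j ≡ adj j i
    irrefl : ∀ i → adj i i ≡ false
open Graph public

Adj : ∀ {n} → Graph n → Fin n → Fin n → Set
Adj G i j = adj G i j ≡ true

data Walk {n : ℕ} (G : Graph n) : Fin n → Fin n → Set where
  here : ∀ {u} → Walk G u u
  step : ∀ {u w v} → Adj G u w → Walk G w v → Walk G u v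

Connected : ∀ {n} → Graph n → Set
Connected {n} G = ∀ (u v : Fin n) → Walk G u v

nextMod : ∀ {l} → Fin (suc l) → Fin (suc l)
nextMod {l} i = Data.Fin.fromℕ< {suc (toℕ i) Data.Nat.% suc l} (Data.Nat.DivMod.m%n<n (suc (toℕ i)) (suc l))
  where import Data.Nat.DivMod

HasCycle : ∀ {n} → Graph n → Set
HasCycle {n} G =
  Σ ℕ λ l → (2 ≤ l) × Σ (Fin (suc l) → Fin n) λ f →
    Injective _≡_ _≡_ f × (∀ i → Adj G (f i) (f (nextMod i)))

IsForest : ∀ {n} → Graph n → Set
IsForest G = ¬ HasCycle G

IsTree : ∀ {n} → Graph n → Set
IsTree G = Connected G × IsForest G

Embeds : ∀ {h n} → Graph h → Graph n → Set
Embeds {h} {n} T G = Σ (Fin h → Fin n) λ φ →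
  Injective _≡_ _≡_ φ × (∀ a b → Adj T a b → Adj G (φ a) (φ b))

Free : ∀ {h n} → Graph h → Graph n → Set
Free T G = ¬ Embeds T G

Edge : ℕ → Set
Edge n = Σ (Fin n × Fin n) λ { (i , j) → toℕ i < toℕ j }

CountIs : ∀ {n} → (Fin n → Fin n → Set) → ℕ → Set
CountIs {n} P m = Σ (List (Fin n × Fin n)) λ xs →
  (length xs ≡ m) × Unique xs
  × All (λ { (i , j) → (toℕ i < toℕ j) × P i j }) xs
  × (∀ i j → toℕ i < toℕ j → P i j → (i , j) ∈ xs)

EdgeCount : ∀ {n} → Graph n → ℕ → Set
EdgeCount G m = CountIs (Adj G) m

IsEx : ∀ {h} → ℕ → Graph h → ℕ → Set
IsEx n T e =
  (Σ (Graph n) λ G → Free T G × EdgeCount G e)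
  × (∀ (G : Graph n) m → Free T G → EdgeCount G m → m ≤ e)

-- k-edge-colourings of K_n (values on the diagonal are irrelevant).
record Colouring (k n : ℕ) : Set where
  field
    col : Fin n → Fin n → Fin k
    col-sym : ∀ i j → col i j ≡ col j i
open Colouring public

record MonoCopy {k n h} (c : Colouring k n) (T : Graph h) : Set where
  field
    colour : Fin k
    φ      : Fin h → Fin n
    φ-inj  : Injective _≡_ _≡_ φ
    mono   : ∀ a b → Adj T a b → col c (φ a) (φ b) ≡ colour
open MonoCopy public

InCopy : ∀ {k n h} {c : Colouring k n} {T : Graph h} →
         MonoCopy c T → Fin n → Fin n → Set
InCopy {T = T} M u v = Σ _ λ a → Σ _ λ b →
  Adj T a b × (φ M a ≡ u) × (φ M b ≡ v)

NIM : ∀ {k n h} → Colouring k n → Graph h → Fin n → Fin n → Set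
NIM c T u v = (u ≢ v) × (∀ (M : MonoCopy c T) → ¬ InCopy M u v)

IsNim : ∀ {h} → ℕ → ℕ → Graph h → ℕ → Set
IsNim k n T m =
  (Σ (Colouring k n) λ c → CountIs (NIM c T) m)
  × (∀ (c : Colouring k n) m′ → CountIs (NIM c T) m′ → m′ ≤ m)

{-# OPTIONS --safe #-}
-- Write e2 for twice the number of edges of a graph.
--
-- Upper bound.  Let Z i be the set of vertices lying on a NIM-edge of colour i.  A monochromatic
-- complete bipartite graph of colour j with parts of size h + 2 avoids Z j, since any further edge
-- of colour j at one of its vertices serves as a leaf edge of a copy of T.  Let W i be the set of
-- vertices belonging to Z j for all j ≠ i.  By the bipartite Ramsey theorem W i and Z i are not both
-- large.  If some W i is large, the colour i contributes O(1) NIM-edges, and every other colour at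
-- most ex(n,T).  If all W i are small, all but O(1) vertices are outside at least two of the Z i.
-- For k = 2 this leaves O(1) NIM-edges.  For a tree T with 2 + d vertices, packing cliques on 1 + d
-- vertices outside Z i shows that colour i has at most ex(n,T) − d (n − |Z i|) / 2 + O(1) NIM-edges;
-- summing over i gives at most k ex(n,T) − d n + O(1), and ex(n,T) ≤ d n because T-free graphs
-- are d-degenerate.
--
-- Lower bound.  For a random permutation the expected overlap of two graphs with O(n) edges on n
-- vertices is O(1), so k − 1 copies of an extremal graph can be placed with O(1) common edges.
-- Give each copy its own colour and all remaining edges the last colour.

module Submission where

open import Defs hiding (sym)
open import Defs using () renaming (sym to adj-sym)
open import Data.Nat using (ℕ; zero; suc; _+_; _*_; _∸_; _^_; _!; _≤_; _<_; _≤?_; _<?_; z≤n; s≤s; ∣_-_∣; NonZero; >-nonZero; >-nonZero⁻¹)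
open import Data.Nat.Properties hiding (_≟_; suc-injective)
open import Data.Nat.Tactic.RingSolver using (solve-∀)
open import Data.Bool using (Bool; true; false; _∧_; _∨_; not; if_then_else_)
import Data.Bool
open import Data.Bool.Properties using (not-involutive; ¬-not)
open import Data.Fin using (Fin; zero; suc; toℕ; punchIn; inject≤; _≟_; fromℕ<)
open import Data.Fin.Properties
  using (any?; all?; punchInᵢ≢i; punchIn-injective; toℕ<n; toℕ-fromℕ<; toℕ-injective; inject≤-injective; pigeonhole; suc-injective)
open import Data.Nat.DivMod using (m<n⇒m%n≡m; n%n≡0)
open import Data.Product using (Σ; ∃; ∃₂; _×_; _,_; proj₁; proj₂)
open import Data.Sum using (_⊎_; inj₁; inj₂)
open import Data.List using (List; []; _∷_; length; filter; cartesianProduct; allFin)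
open import Data.List.Membership.Propositional using (_∈_)
open import Data.List.Membership.Propositional.Properties
  using (∈-filter⁺; ∈-cartesianProduct⁺; ∈-allFin)
open import Data.List.Relation.Unary.Any using () renaming (here to hereₗ; there to thereₗ)
open import Data.List.Relation.Unary.All as All using ([]; _∷_)
open import Data.List.Relation.Unary.All.Properties using (all-filter; All¬⇒¬Any)
open import Data.List.Relation.Unary.AllPairs using ([]; _∷_)
open import Data.List.Relation.Unary.Unique.Propositional using (Unique)
open import Data.List.Relation.Unary.Unique.Propositional.Properties
  using (filter⁺; cartesianProduct⁺; allFin⁺)
open import Data.Empty using (⊥; ⊥-elim)
open import Relation.Nullary using (¬_; Dec; yes; no; does; contradiction)
open import Relation.Nullary.Decidable using (dec-true; dec-false; _×-dec_; _→-dec_; ¬?; decidable-stable; ¬¬-excluded-middle)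
open import Relation.Binary.PropositionalEquality hiding (J; [_])
open import Relation.Binary.Definitions using (tri<; tri≈; tri>)
open import Function using (_∘_; id; flip)
open import Function.Definitions using (Injective)
import Algebra.Properties.Semiring.Sum +-*-semiring as Sum

-- Counting subsets of Fin n

⟦_⟧ : Bool → ℕ
⟦ true ⟧ = 1
⟦ false ⟧ = 0

∧⁻ : ∀ {p q} → p ∧ q ≡ true → p ≡ true × q ≡ true
∧⁻ {true} {true} _ = refl , refl

∧⁺ : ∀ {p q} → p ≡ true → q ≡ true → p ∧ q ≡ true
∧⁺ refl refl = refl

true≢false : ∀ {p} → p ≡ true → p ≡ false → ⊥
true≢false refl ()

not⁻ : ∀ {p} → not p ≡ true → p ≡ false
not⁻ {false} _ = refl

does⁻ : ∀ {a} {A : Set a} (d : Dec A) → does d ≡ true → A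
does⁻ (yes x) _ = x

true? : ∀ b → Dec (b ≡ true)
true? b = b Data.Bool.≟ true

⟦⟧-mono : ∀ {p q} → (p ≡ true → q ≡ true) → ⟦ p ⟧ ≤ ⟦ q ⟧
⟦⟧-mono {true}  p⇒q = ≤-reflexive (cong ⟦_⟧ (sym (p⇒q refl)))
⟦⟧-mono {false} p⇒q = z≤n

-- As `∑` does not unfold, the laws of this block are its whole interface.
opaque
  ∑ : ∀ {n} → (Fin n → ℕ) → ℕ
  ∑ = Sum.sum

  ∑-empty : (f : Fin 0 → ℕ) → ∑ f ≡ 0
  ∑-empty f = refl

  ∑-suc : ∀ {n} (f : Fin (suc n) → ℕ) → ∑ f ≡ f zero + ∑ (f ∘ suc)
  ∑-suc f = refl

  ∑-cong : ∀ {n} {f g : Fin n → ℕ} → (∀ i → f i ≡ g i) → ∑ f ≡ ∑ g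
  ∑-cong = Sum.sum-cong-≗

  ∑-remove : ∀ {n} (f : Fin (suc n) → ℕ) i → ∑ f ≡ f i + ∑ (f ∘ punchIn i)
  ∑-remove f i = Sum.sum-remove f

  ∑-+ : ∀ {n} (f g : Fin n → ℕ) → ∑ (λ i → f i + g i) ≡ ∑ f + ∑ g
  ∑-+ = Sum.∑-distrib-+

  ∑-comm : ∀ {m n} (f : Fin m → Fin n → ℕ) → ∑ (λ i → ∑ (λ j → f i j)) ≡ ∑ (λ j → ∑ (λ i → f i j))
  ∑-comm = Sum.∑-comm

  ∑-*ˡ : ∀ {n} c (f : Fin n → ℕ) → c * ∑ f ≡ ∑ (λ i → c * f i)
  ∑-*ˡ = Sum.*-distribˡ-sum

∑-mono : ∀ {n} {f g : Fin n → ℕ} → (∀ i → f i ≤ g i) → ∑ f ≤ ∑ g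
∑-mono {zero}  {f} {g} f≤g rewrite ∑-empty f | ∑-empty g = z≤n
∑-mono {suc n} {f} {g} f≤g rewrite ∑-suc f | ∑-suc g = +-mono-≤ (f≤g zero) (∑-mono (f≤g ∘ suc))

∑-const : ∀ n c → ∑ {n} (λ _ → c) ≡ n * c
∑-const zero    c = ∑-empty _
∑-const (suc n) c = trans (∑-suc _) (cong (c +_) (∑-const n c))

∑-zero : ∀ {n} {f : Fin n → ℕ} → (∀ i → f i ≡ 0) → ∑ f ≡ 0
∑-zero {n} f≡0 = trans (∑-cong f≡0) (trans (∑-const n 0) (*-zeroʳ n))

∑≤const : ∀ {n c} {f : Fin n → ℕ} → (∀ i → f i ≤ c) → ∑ f ≤ n * c
∑≤const {n} {c} f≤c = ≤-trans (∑-mono f≤c) (≤-reflexive (∑-const n c))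

const≤∑ : ∀ {n c} {f : Fin n → ℕ} → (∀ i → c ≤ f i) → n * c ≤ ∑ f
const≤∑ {n} {c} c≤f = ≤-trans (≤-reflexive (sym (∑-const n c))) (∑-mono c≤f)

term≤∑ : ∀ {n} (f : Fin n → ℕ) i → f i ≤ ∑ f
term≤∑ f zero    = ≤-trans (m≤m+n _ _) (≤-reflexive (sym (∑-suc f)))
term≤∑ f (suc i) = ≤-trans (term≤∑ (f ∘ suc) i) (≤-trans (m≤n+m _ _) (≤-reflexive (sym (∑-suc f))))

∑-single : ∀ {n} (f : Fin n → ℕ) x → ∑ (λ v → ⟦ does (v ≟ x) ⟧ * f v) ≡ f x
∑-single {suc n} f x = begin
  ∑ g                           ≡⟨ ∑-remove g x ⟩
  g x + ∑ (g ∘ punchIn x)       ≡⟨ cong₂ _+_ gx rest ⟩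
  f x + 0                         ≡⟨ +-identityʳ _ ⟩
  f x                             ∎
  where
  open ≡-Reasoning
  g : Fin (suc n) → ℕ
  g v = ⟦ does (v ≟ x) ⟧ * f v
  gx : g x ≡ f x
  gx = trans (cong (λ b → ⟦ b ⟧ * f x) (dec-true (x ≟ x) refl)) (*-identityˡ _)
  rest : ∑ (g ∘ punchIn x) ≡ 0
  rest = ∑-zero λ i → cong (λ b → ⟦ b ⟧ * f (punchIn x i)) (dec-false (punchIn x i ≟ x) (punchInᵢ≢i x i))

∑-≟ : ∀ {n} (x : Fin n) → ∑ (λ v → ⟦ does (v ≟ x) ⟧) ≡ 1
∑-≟ {n} x = trans (∑-cong {n} (λ v → sym (*-identityʳ ⟦ does (v ≟ x) ⟧))) (∑-single (λ _ → 1) x)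

-- The minimum is at most the average, in a form without division: were `suc n * f x` larger than
-- `∑ f` for every `x`, summing over `x` would give a contradiction.
∑-min : ∀ {n} (f : Fin (suc n) → ℕ) → ∃ λ x → suc n * f x ≤ ∑ f
∑-min {n} f with any? (λ x → suc n * f x ≤? ∑ f)
... | yes p = p
... | no ∄x = contradiction (*-cancelˡ-≤ (suc n) big) (<⇒≱ ≤-refl)
  where
  big : suc n * suc (∑ f) ≤ suc n * ∑ f
  big = ≤-trans (const≤∑ (λ x → ≰⇒> (∄x ∘ (x ,_)))) (≤-reflexive (sym (∑-*ˡ (suc n) f)))

cnt : ∀ {n} → (Fin n → Bool) → ℕ
cnt P = ∑ (λ v → ⟦ P v ⟧)

_⊆_ : ∀ {n} → (Fin n → Bool) → (Fin n → Bool) → Set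
P ⊆ Q = ∀ {v} → P v ≡ true → Q v ≡ true

infixl 6 _∖_
_∖_ : ∀ {n} → (Fin n → Bool) → Fin n → Fin n → Bool
(P ∖ z) v = P v ∧ not (does (v ≟ z))

∖⁻ : ∀ {n} (P : Fin n → Bool) {z v} → (P ∖ z) v ≡ true → P v ≡ true × v ≢ z
∖⁻ P {z} {v} p with ∧⁻ p
... | Pv , q = Pv , λ v≡z → true≢false (dec-true (v ≟ z) v≡z) (not⁻ q)

∖⁺ : ∀ {n} (P : Fin n → Bool) {z v} → P v ≡ true → v ≢ z → (P ∖ z) v ≡ true
∖⁺ P {z} {v} Pv v≢z = ∧⁺ Pv (cong not (dec-false (v ≟ z) v≢z))

cnt-mono : ∀ {n} {P Q : Fin n → Bool} → P ⊆ Q → cnt P ≤ cnt Q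
cnt-mono P⊆Q = ∑-mono (λ v → ⟦⟧-mono P⊆Q)

cnt≤n : ∀ {n} (P : Fin n → Bool) → cnt P ≤ n
cnt≤n {n} P = ≤-trans (∑≤const {c = 1} (λ v → ⟦⟧-mono {q = true} (λ _ → refl))) (≤-reflexive (*-identityʳ n))

cnt-true : ∀ {n} {P : Fin n → Bool} → (∀ v → P v ≡ true) → cnt P ≡ n
cnt-true {n} Pv = trans (∑-cong {n} (cong ⟦_⟧ ∘ Pv)) (trans (∑-const n 1) (*-identityʳ n))

cnt-∖ : ∀ {n} (P : Fin n → Bool) z → cnt P ≤ suc (cnt (P ∖ z))
cnt-∖ P z = ≤-trans (∑-mono pointwise) (≤-reflexive (trans (∑-+ _ _) (cong (_+ cnt (P ∖ z)) (∑-≟ z))))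
  where
  pointwise : ∀ v → ⟦ P v ⟧ ≤ ⟦ does (v ≟ z) ⟧ + ⟦ (P ∖ z) v ⟧
  pointwise v with P v | does (v ≟ z)
  ... | true  | true  = ≤-refl
  ... | true  | false = ≤-refl
  ... | false | _     = z≤n

cnt-∖-∈ : ∀ {n} (P : Fin n → Bool) {z} → P z ≡ true → cnt P ≡ suc (cnt (P ∖ z))
cnt-∖-∈ {n} P {z} Pz = trans (∑-cong {n} pointwise) (trans (∑-+ {n} _ _) (cong (_+ cnt (P ∖ z)) (∑-≟ z)))
  where
  pointwise : ∀ v → ⟦ P v ⟧ ≡ ⟦ does (v ≟ z) ⟧ + ⟦ (P ∖ z) v ⟧
  pointwise v with P v in Pv | v ≟ z
  ... | true  | yes _   = refl
  ... | true  | no _    = refl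
  ... | false | yes v≡z = contradiction Pv (true≢false (trans (cong P v≡z) Pz))
  ... | false | no _    = refl

_─_ : ∀ {n} → (Fin n → Bool) → (Fin n → Bool) → Fin n → Bool
(S ─ K) v = S v ∧ not (K v)

cnt-─ : ∀ {n} {S K : Fin n → Bool} → K ⊆ S → cnt S ≡ cnt K + cnt (S ─ K)
cnt-─ {S = S} {K} K⊆S = trans (∑-cong pointwise) (∑-+ _ _)
  where
  pointwise : ∀ v → ⟦ S v ⟧ ≡ ⟦ K v ⟧ + ⟦ (S ─ K) v ⟧
  pointwise v with S v in Sv | K v in Kv
  ... | true  | true  = refl
  ... | true  | false = refl
  ... | false | true  = contradiction Sv (true≢false (K⊆S Kv))
  ... | false | false = refl

cnt-∃ : ∀ {n} (P : Fin n → Bool) → 0 < cnt P → ∃ λ v → P v ≡ true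
cnt-∃ P 0<c with any? (λ v → true? (P v))
... | yes p = p
... | no ∄v = contradiction (∑-zero (λ v → cong ⟦_⟧ (¬-not (∄v ∘ (v ,_))))) (>⇒≢ 0<c)

∃-cnt : ∀ {n} (P : Fin n → Bool) {v} → P v ≡ true → 0 < cnt P
∃-cnt P {v} Pv = ≤-trans (≤-reflexive (sym (cong ⟦_⟧ Pv))) (term≤∑ (λ v → ⟦ P v ⟧) v)

cnt-∃-≢ : ∀ {n} (P : Fin n → Bool) → 2 ≤ cnt P → ∀ z → ∃ λ v → P v ≡ true × v ≢ z
cnt-∃-≢ P 2≤c z with cnt-∃ (P ∖ z) (≤-pred (≤-trans 2≤c (cnt-∖ P z)))
... | v , p = v , ∖⁻ P p

cnt≤1-unique : ∀ {n} (P : Fin n → Bool) → cnt P ≤ 1 → ∀ {s t} → P s ≡ true → P t ≡ true → s ≡ t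
cnt≤1-unique P c≤1 {s} {t} Ps Pt with s ≟ t
... | yes s≡t = s≡t
... | no s≢t = contradiction (≤-trans (s≤s (∃-cnt (P ∖ s) (∖⁺ P Pt (s≢t ∘ sym)))) (≤-reflexive (sym (cnt-∖-∈ P Ps)))) (<⇒≱ (s≤s c≤1))

injective⇒≤cnt : ∀ {m n} (P : Fin n → Bool) (f : Fin m → Fin n) → Injective _≡_ _≡_ f →
  (∀ a → P (f a) ≡ true) → m ≤ cnt P
injective⇒≤cnt {zero}  P f f-inj Pf = z≤n
injective⇒≤cnt {suc m} P f f-inj Pf = ≤-trans
  (s≤s (injective⇒≤cnt (P ∖ f zero) (f ∘ suc) (suc-injective ∘ f-inj)
    (λ a → ∖⁺ P (Pf (suc a)) (λ eq → case-0≢suc (f-inj eq)))))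
  (≤-reflexive (sym (cnt-∖-∈ P (Pf zero))))
  where
  case-0≢suc : ∀ {a : Fin m} → Fin.suc a ≢ zero
  case-0≢suc ()

-- With its converse `injective⇒≤cnt`, this passes between sizes of Boolean predicates and
-- injections from some `Fin m`, the form in which copies of `T` are built.
≤cnt⇒injective : ∀ {n} m (P : Fin n → Bool) → m ≤ cnt P →
  Σ (Fin m → Fin n) λ f → Injective _≡_ _≡_ f × (∀ a → P (f a) ≡ true)
≤cnt⇒injective zero    P _ = (λ ()) , (λ { {()} }) , λ ()
≤cnt⇒injective {n} (suc m) P m<c with cnt-∃ P (≤-trans (s≤s z≤n) m<c)
... | v , Pv with ≤cnt⇒injective m (P ∖ v) (≤-pred (≤-trans m<c (cnt-∖ P v)))
...   | f , f-inj , Pf = f' , f'-inj , λ { zero → Pv ; (suc a) → proj₁ (∖⁻ P (Pf a)) }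
  where
  f' : Fin (suc m) → Fin n
  f' zero    = v
  f' (suc a) = f a
  f'-inj : Injective _≡_ _≡_ f'
  f'-inj {zero}  {zero}  _  = refl
  f'-inj {zero}  {suc b} eq = contradiction (sym eq) (proj₂ (∖⁻ P (Pf b)))
  f'-inj {suc a} {zero}  eq = contradiction eq (proj₂ (∖⁻ P (Pf a)))
  f'-inj {suc a} {suc b} eq = cong suc (f-inj eq)

cnt-avoid : ∀ {h n} m (A : Fin n → Bool) (P : Fin h → Bool) (φ : Fin h → Fin n) →
  cnt P ≤ m → m < cnt A → ∃ λ y → A y ≡ true × (∀ {t} → P t ≡ true → y ≢ φ t)
cnt-avoid {h} m A P φ P≤m m<A with any? (λ t → true? (P t))
... | no ∄t = let y , Ay = cnt-∃ A (≤-trans (s≤s z≤n) m<A) in y , Ay , λ {t} Pt _ → ∄t (t , Pt)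
cnt-avoid zero A P φ P≤m m<A | yes (t , Pt) = contradiction (∃-cnt P Pt) (≤⇒≯ P≤m)
cnt-avoid (suc m) A P φ P≤m m<A | yes (t , Pt)
  with cnt-avoid m (A ∖ φ t) (P ∖ t) φ
         (≤-pred (≤-trans (≤-reflexive (sym (cnt-∖-∈ P Pt))) P≤m)) (≤-pred (≤-trans m<A (cnt-∖ A (φ t))))
... | y , A'y , y∉ = y , proj₁ (∖⁻ A A'y) , avoid
  where
  avoid : ∀ {s} → P s ≡ true → y ≢ φ s
  avoid {s} Ps with s ≟ t
  ... | yes refl = proj₂ (∖⁻ A A'y)
  ... | no s≢t = y∉ (∖⁺ P Ps s≢t)

cnt-subset : ∀ {n} m (S : Fin n → Bool) → m ≤ cnt S → Σ (Fin n → Bool) λ K → (K ⊆ S) × cnt K ≡ m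
cnt-subset {n} zero S _ = (λ _ → false) , (λ ()) , ∑-zero {n} (λ _ → refl)
cnt-subset {n} (suc m) S m<c with cnt-∃ S (≤-trans (s≤s z≤n) m<c)
... | v , Sv with cnt-subset m (S ∖ v) (≤-pred (≤-trans m<c (cnt-∖ S v)))
...   | K , K⊆ , cK = K' , K'⊆S , trans (∑-cong {n} pointwise) (trans (∑-+ {n} _ _) (cong₂ _+_ (∑-≟ v) cK))
  where
  K' : Fin n → Bool
  K' u = does (u ≟ v) ∨ K u
  K'⊆S : K' ⊆ S
  K'⊆S {u} p with u ≟ v
  ... | yes refl = Sv
  ... | no _ = proj₁ (∖⁻ S (K⊆ p))
  pointwise : ∀ u → ⟦ K' u ⟧ ≡ ⟦ does (u ≟ v) ⟧ + ⟦ K u ⟧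
  pointwise u with u ≟ v | K u in Ku
  ... | yes u≡v | true  = contradiction u≡v (proj₂ (∖⁻ S (K⊆ Ku)))
  ... | yes _   | false = refl
  ... | no _    | _     = refl

cnt-fibre : ∀ {n k} (χ : Fin n → Fin k) (P : Fin n → Bool) →
  ∑ (λ j → cnt (λ v → P v ∧ does (j ≟ χ v))) ≡ cnt P
cnt-fibre {n} {k} χ P = trans (∑-comm {k} {n} _) (∑-cong {n} fibre)
  where
  fibre : ∀ v → ∑ (λ j → ⟦ P v ∧ does (j ≟ χ v) ⟧) ≡ ⟦ P v ⟧
  fibre v with P v
  ... | true  = ∑-≟ (χ v)
  ... | false = ∑-zero {k} (λ _ → refl)

cnt-pigeonhole : ∀ {n k} (χ : Fin n → Fin (suc k)) (P : Fin n → Bool) s → suc k * s ≤ cnt P →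
  ∃ λ j → s ≤ cnt (λ v → P v ∧ does (j ≟ χ v))
cnt-pigeonhole {n} {k} χ P s ks≤c with any? (λ j → s ≤? cnt (λ v → P v ∧ does (j ≟ χ v)))
... | yes p = p
... | no ∄j = contradiction (≤-trans many ks≤c) (<⇒≱ (s≤s (m≤n+m (cnt P) k)))
  where
  -- If every class has fewer than `s` elements, one extra unit per class still fits under
  -- `suc k * s`.
  many : suc k + cnt P ≤ suc k * s
  many = begin
    suc k + cnt P ≡⟨ cong₂ _+_ (sym (trans (∑-const (suc k) 1) (*-identityʳ _))) (sym (cnt-fibre χ P)) ⟩
    ∑ {suc k} (λ _ → 1) + ∑ (λ j → cnt (λ v → P v ∧ does (j ≟ χ v))) ≡⟨ sym (∑-+ {suc k} _ _) ⟩
    ∑ (λ j → suc (cnt (λ v → P v ∧ does (j ≟ χ v)))) ≤⟨ ∑≤const (λ j → ≰⇒> (∄j ∘ (j ,_))) ⟩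
    suc k * s ∎
    where open ≤-Reasoning

-- Edge counts as double sums

-- Counting ordered pairs keeps the sum symmetric, so that it can be exchanged and reindexed; for
-- graphs it is twice the edge number.
e2 : ∀ {n} → (Fin n → Fin n → Bool) → ℕ
e2 b = ∑ λ u → cnt (b u)

e2-mono : ∀ {n} {b c : Fin n → Fin n → Bool} → (∀ {u v} → b u v ≡ true → c u v ≡ true) → e2 b ≤ e2 c
e2-mono b⇒c = ∑-mono (λ u → ∑-mono (λ v → ⟦⟧-mono b⇒c))

-- For a duplicate-free list this is the indicator of membership, which turns the lists of `CountIs`
-- into double sums.
multiplicity : ∀ {n} → List (Fin n × Fin n) → Fin n → Fin n → ℕ
multiplicity []             i j = 0
multiplicity ((a , b) ∷ xs) i j = ⟦ does (i ≟ a) ⟧ * ⟦ does (j ≟ b) ⟧ + multiplicity xs i j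

∑-multiplicity : ∀ {n} (xs : List (Fin n × Fin n)) → ∑ (λ i → ∑ (multiplicity xs i)) ≡ length xs
∑-multiplicity []       = ∑-zero (λ i → ∑-zero (λ j → refl))
∑-multiplicity {n} ((a , b) ∷ xs) = begin
  ∑ (λ i → ∑ (λ j → δ i j + multiplicity xs i j))            ≡⟨ ∑-cong (λ i → ∑-+ (δ i) (multiplicity xs i)) ⟩
  ∑ (λ i → ∑ (δ i) + ∑ (multiplicity xs i))                  ≡⟨ ∑-+ _ _ ⟩
  ∑ (λ i → ∑ (δ i)) + ∑ (λ i → ∑ (multiplicity xs i))        ≡⟨ cong₂ _+_ one (∑-multiplicity xs) ⟩
  suc (length xs)                                            ∎
  where
  open ≡-Reasoning
  δ : Fin n → Fin n → ℕ
  δ i j = ⟦ does (i ≟ a) ⟧ * ⟦ does (j ≟ b) ⟧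
  one : ∑ (λ i → ∑ (δ i)) ≡ 1
  one = trans (∑-cong (λ i → sym (∑-*ˡ ⟦ does (i ≟ a) ⟧ (λ j → ⟦ does (j ≟ b) ⟧))))
          (trans (∑-single (λ _ → ∑ (λ j → ⟦ does (j ≟ b) ⟧)) a) (∑-≟ b))

multiplicity-∉ : ∀ {n} (xs : List (Fin n × Fin n)) {i j} → ¬ (i , j) ∈ xs → multiplicity xs i j ≡ 0
multiplicity-∉ [] _ = refl
multiplicity-∉ ((a , b) ∷ xs) {i} {j} ∉xs with i ≟ a | j ≟ b
... | yes refl | yes refl = contradiction (hereₗ refl) ∉xs
... | yes _    | no _     = multiplicity-∉ xs (∉xs ∘ thereₗ)
... | no _     | _        = multiplicity-∉ xs (∉xs ∘ thereₗ)

multiplicity-∈ : ∀ {n} {xs : List (Fin n × Fin n)} {i j} → Unique xs → (i , j) ∈ xs → multiplicity xs i j ≡ 1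
multiplicity-∈ {xs = (a , b) ∷ xs} (∉xs ∷ _) (hereₗ refl) =
  cong₂ _+_ (cong₂ (λ p q → ⟦ p ⟧ * ⟦ q ⟧) (dec-true (a ≟ a) refl) (dec-true (b ≟ b) refl))
    (multiplicity-∉ xs (All¬⇒¬Any ∉xs))
multiplicity-∈ {xs = (a , b) ∷ xs} {i} {j} (∉xs ∷ uniq) (thereₗ ∈xs) with i ≟ a | j ≟ b
... | yes refl | yes refl = contradiction ∈xs (All¬⇒¬Any ∉xs)
... | yes _    | no _     = multiplicity-∈ uniq ∈xs
... | no _     | _        = multiplicity-∈ uniq ∈xs

-- The list holds each edge once, with its smaller end first. By trichotomy and symmetry the
-- indicator of `b` is the multiplicity plus its transpose, and both have sum `m`.
e2-CountIs : ∀ {n m} {P : Fin n → Fin n → Set} (b : Fin n → Fin n → Bool) →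
  (∀ i j → b i j ≡ b j i) → (∀ i → b i i ≡ false) →
  (∀ {i j} → b i j ≡ true → P i j) → (∀ {i j} → P i j → b i j ≡ true) →
  CountIs P m → e2 b ≡ 2 * m
e2-CountIs {n} {m} {P} b b-sym b-irrefl b⇒P P⇒b (xs , len , uniq , sound , complete) = begin
  ∑ (λ i → ∑ (λ j → ⟦ b i j ⟧))                      ≡⟨ ∑-cong (λ i → ∑-cong (split i)) ⟩
  ∑ (λ i → ∑ (λ j → μ i j + μ j i))                  ≡⟨ ∑-cong (λ i → ∑-+ (μ i) (λ j → μ j i)) ⟩
  ∑ (λ i → ∑ (μ i) + ∑ (λ j → μ j i))                ≡⟨ ∑-+ _ _ ⟩
  ∑ (λ i → ∑ (μ i)) + ∑ (λ i → ∑ (λ j → μ j i))      ≡⟨ cong (∑ (λ i → ∑ (μ i)) +_) (∑-comm (λ i j → μ j i)) ⟩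
  ∑ (λ i → ∑ (μ i)) + ∑ (λ i → ∑ (μ i))              ≡⟨ cong₂ _+_ total (trans total (sym (+-identityʳ m))) ⟩
  2 * m                                              ∎
  where
  open ≡-Reasoning
  μ : Fin n → Fin n → ℕ
  μ = multiplicity xs
  total : ∑ (λ i → ∑ (μ i)) ≡ m
  total = trans (∑-multiplicity xs) len
  ordered : ∀ {i j} → ¬ toℕ i < toℕ j → μ i j ≡ 0
  ordered i≮j = multiplicity-∉ xs (λ ∈xs → i≮j (proj₁ (All.lookup sound ∈xs)))
  above : ∀ {i j} → toℕ i < toℕ j → μ i j ≡ ⟦ b i j ⟧
  above {i} {j} i<j with b i j in bij
  ... | true  = multiplicity-∈ uniq (complete i j i<j (b⇒P bij))
  ... | false = multiplicity-∉ xs (λ ∈xs → true≢false (P⇒b (proj₂ (All.lookup sound ∈xs))) bij)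
  split : ∀ i j → ⟦ b i j ⟧ ≡ μ i j + μ j i
  split i j with <-cmp (toℕ i) (toℕ j)
  ... | tri< i<j _ j≮i = sym (trans (cong₂ _+_ (above i<j) (ordered j≮i)) (+-identityʳ _))
  ... | tri> i≮j _ j<i = trans (cong ⟦_⟧ (b-sym i j)) (sym (cong₂ _+_ (ordered i≮j) (above j<i)))
  ... | tri≈ i≮j i≡j j≮i with toℕ-injective i≡j
  ...   | refl = trans (cong ⟦_⟧ (b-irrefl i)) (sym (cong₂ _+_ (ordered i≮j) (ordered j≮i)))

-- The maxima in `IsEx` and `IsNim` speak only of objects with a given count; this provides the
-- count.
∃-CountIs : ∀ {n} {P : Fin n → Fin n → Set} → (∀ i j → Dec (P i j)) → ∃ (CountIs P)
∃-CountIs {n} {P} P? = length xs , xs , refl ,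
  filter⁺ Q? (cartesianProduct⁺ (allFin⁺ n) (allFin⁺ n)) ,
  All.map (λ { {i , j} p → p }) (all-filter Q? pairs) ,
  λ i j i<j p → ∈-filter⁺ Q? (∈-cartesianProduct⁺ (∈-allFin i) (∈-allFin j)) (i<j , p)
  where
  pairs : List (Fin n × Fin n)
  pairs = cartesianProduct (allFin n) (allFin n)
  Q? : (p : Fin n × Fin n) → Dec (toℕ (proj₁ p) < toℕ (proj₂ p) × P (proj₁ p) (proj₂ p))
  Q? (i , j) = (toℕ i <? toℕ j) ×-dec P? i j
  xs : List (Fin n × Fin n)
  xs = filter Q? pairs

-- `NIM` quantifies over all copies of `T`, and its decidability is assumed only under a double
-- negation. Finite quantifiers commute with double negation, and the final inequality is stable.
¬¬-Fin : ∀ {n} {P : Fin n → Set} → (∀ i → ¬ ¬ P i) → ¬ ¬ (∀ i → P i)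
¬¬-Fin {zero}  _   ¬∀ = ¬∀ λ ()
¬¬-Fin {suc n} ¬¬P ¬∀ = ¬¬P zero λ p₀ → ¬¬-Fin (¬¬P ∘ suc) λ ps → ¬∀ λ { zero → p₀ ; (suc i) → ps i }

¬¬-Dec₂ : ∀ {n} (P : Fin n → Fin n → Set) → ¬ ¬ (∀ i j → Dec (P i j))
¬¬-Dec₂ P = ¬¬-Fin (λ i → ¬¬-Fin (λ j → ¬¬-excluded-middle))

module _ {n h : ℕ} {T : Graph h} where

  e2-Graph : ∀ {m} (G : Graph n) → EdgeCount G m → e2 (adj G) ≡ 2 * m
  e2-Graph G = e2-CountIs (adj G) (adj-sym G) (irrefl G) id id

  IsEx⇒e2≤ : ∀ {e} → IsEx n T e → (G : Graph n) → Free T G → e2 (adj G) ≤ 2 * e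
  IsEx⇒e2≤ (_ , maximal) G G-free with ∃-CountIs (λ i j → true? (adj G i j))
  ... | m , count = ≤-trans (≤-reflexive (e2-Graph G count)) (*-monoʳ-≤ 2 (maximal G m G-free count))

  IsEx⇒extremal : ∀ {e} → IsEx n T e → Σ (Graph n) λ G → Free T G × e2 (adj G) ≡ 2 * e
  IsEx⇒extremal ((G , G-free , count) , _) = G , G-free , e2-Graph G count

module _ {k n h} {T : Graph h} {c : Colouring k n} where

  NIM-sym : ∀ {u v} → NIM c T u v → NIM c T v u
  NIM-sym (u≢v , nim) = u≢v ∘ sym , λ M (a , b , ab , φa≡v , φb≡u) →
    nim M (b , a , trans (adj-sym T b a) ab , φb≡u , φa≡v)

  module _ (D : ∀ u v → Dec (NIM c T u v)) where

    nim : Fin n → Fin n → Bool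
    nim u v = does (D u v)

    nim⁻ : ∀ {u v} → nim u v ≡ true → NIM c T u v
    nim⁻ {u} {v} = does⁻ (D u v)

    nim⁺ : ∀ {u v} → NIM c T u v → nim u v ≡ true
    nim⁺ {u} {v} = dec-true (D u v)

    nim-sym : ∀ u v → nim u v ≡ nim v u
    nim-sym u v with nim u v in uv
    ... | true  = sym (nim⁺ (NIM-sym (nim⁻ uv)))
    ... | false = sym (dec-false (D v u) (λ vu → true≢false (nim⁺ (NIM-sym vu)) uv))

    nim-irrefl : ∀ u → nim u u ≡ false
    nim-irrefl u = dec-false (D u u) (λ p → proj₁ p refl)

    e2-nim : ∀ {m} → CountIs (NIM c T) m → e2 nim ≡ 2 * m
    e2-nim = e2-CountIs nim nim-sym nim-irrefl nim⁻ nim⁺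

    IsNim⇒e2≤ : ∀ {a} → IsNim k n T a → e2 nim ≤ 2 * a
    IsNim⇒e2≤ (_ , maximal) with ∃-CountIs D
    ... | m , count = ≤-trans (≤-reflexive (e2-nim count)) (*-monoʳ-≤ 2 (maximal c m count))

-- Forests

Adj-irrefl : ∀ {n} (G : Graph n) {u v} → Adj G u v → u ≢ v
Adj-irrefl G {u} uv refl = true≢false uv (irrefl G u)

Adj-sym : ∀ {n} (G : Graph n) {u v} → Adj G u v → Adj G v u
Adj-sym G {u} {v} uv = trans (adj-sym G v u) uv

nbrs : ∀ {n} → Graph n → (Fin n → Bool) → Fin n → Fin n → Bool
nbrs G P x y = P y ∧ adj G x y

nextMod-cases : ∀ {l} (i : Fin (suc l)) →
  (toℕ i < l × toℕ (nextMod i) ≡ suc (toℕ i)) ⊎ (toℕ i ≡ l × toℕ (nextMod i) ≡ 0)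
nextMod-cases {l} i with m≤n⇒m<n∨m≡n (≤-pred (toℕ<n i))
... | inj₁ i<l = inj₁ (i<l , trans (toℕ-fromℕ< _) (m<n⇒m%n≡m (s≤s i<l)))
... | inj₂ i≡l = inj₂ (i≡l , trans (toℕ-fromℕ< _) (trans (cong (λ t → suc t Data.Nat.DivMod.% suc l) i≡l) (n%n≡0 (suc l))))

module _ {h} (T : Graph h) where

  -- Only the values p 0, …, p m are relevant.
  record IsPath (P : Fin h → Bool) (m : ℕ) (p : ℕ → Fin h) : Set where
    field
      start    : P (p 0) ≡ true
      edges    : ∀ {t} → t < m → Adj T (p t) (p (suc t))
      distinct : ∀ {s t} → s ≤ m → t ≤ m → p s ≡ p t → s ≡ t
  open IsPath

  closing-edge : ∀ {P m p} → IsPath P m p → ∀ {l} → 2 ≤ l → l ≤ m → Adj T (p l) (p 0) → HasCycle T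
  closing-edge {P} {m} {p} path {l} 2≤l l≤m close = l , 2≤l , p ∘ toℕ ,
    (λ {s} {t} eq → toℕ-injective (distinct path (bound s) (bound t) eq)) , edge
    where
    bound : (t : Fin (suc l)) → toℕ t ≤ m
    bound t = ≤-trans (≤-pred (toℕ<n t)) l≤m
    edge : ∀ i → Adj T (p (toℕ i)) (p (toℕ (nextMod i)))
    edge i with nextMod-cases i
    ... | inj₁ (i<l , next) rewrite next = edges path (≤-trans i<l l≤m)
    ... | inj₂ (i≡l , next) rewrite next | i≡l = close

  module _ {P : Fin h → Bool} (minDeg : ∀ x → P x ≡ true → 2 ≤ cnt (nbrs T P x)) where

    -- The path grows at its front: a neighbour of `p 0` other than `p 1` either lies on the path,
    -- closing a cycle, or prolongs it.
    extend-path : ∀ {m p} → IsPath P m p → HasCycle T ⊎ ∃ (IsPath P (suc m))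
    -- For `m = 0` the value `p 1` is arbitrary; avoiding it does no harm, as two neighbours are
    -- available.
    extend-path {m} {p} path with cnt-∃-≢ (nbrs T P (p 0)) (minDeg (p 0) (start path)) (p 1)
    ... | y , nbr , y≢p1 with ∧⁻ nbr
    ...   | Py , p0y with any? (λ (i : Fin (suc m)) → p (toℕ i) ≟ y)
    ...     | yes (i , pi≡y) = inj₁ (closing-edge path (2≤ (toℕ i) pi≡y) (≤-pred (toℕ<n i))
                (subst (λ z → Adj T z (p 0)) (sym pi≡y) (Adj-sym T p0y)))
      where
      2≤ : ∀ t → p t ≡ y → 2 ≤ t
      2≤ 0             eq = contradiction eq (Adj-irrefl T p0y)
      2≤ 1             eq = contradiction (sym eq) y≢p1
      2≤ (suc (suc t)) eq = s≤s (s≤s z≤n)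
    ...     | no y∉path = inj₂ (q , record { start = Py ; edges = q-edges ; distinct = q-distinct })
      where
      q : ℕ → Fin h
      q zero    = y
      q (suc t) = p t
      fresh : ∀ {t} → t ≤ m → p t ≢ y
      fresh {t} t≤m pt≡y = y∉path (fromℕ< (s≤s t≤m) , trans (cong p (toℕ-fromℕ< (s≤s t≤m))) pt≡y)
      q-edges : ∀ {t} → t < suc m → Adj T (q t) (q (suc t))
      q-edges {zero}  _         = Adj-sym T p0y
      q-edges {suc t} (s≤s t<m) = edges path t<m
      q-distinct : ∀ {s t} → s ≤ suc m → t ≤ suc m → q s ≡ q t → s ≡ t
      q-distinct {zero}  {zero}  _         _         _  = refl
      q-distinct {zero}  {suc t} _         (s≤s t≤m) eq = contradiction (sym eq) (fresh t≤m)
      q-distinct {suc s} {zero}  (s≤s s≤m) _         eq = contradiction eq (fresh s≤m)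
      q-distinct {suc s} {suc t} (s≤s s≤m) (s≤s t≤m) eq = cong suc (distinct path s≤m t≤m eq)

    cycle-or-path : ∀ {x} → P x ≡ true → ∀ m → HasCycle T ⊎ ∃ (IsPath P m)
    cycle-or-path {x} Px zero = inj₂ ((λ _ → x) , record
      { start = Px ; edges = λ () ; distinct = λ { z≤n z≤n _ → refl } })
    cycle-or-path Px (suc m) with cycle-or-path Px m
    ... | inj₁ cycle      = inj₁ cycle
    ... | inj₂ (p , path) = extend-path path

    -- Without a cycle the path could be extended to `h + 1` distinct vertices among `h`.
    minDeg≥2⇒HasCycle : ∀ {x} → P x ≡ true → HasCycle T
    minDeg≥2⇒HasCycle Px with cycle-or-path Px h
    ... | inj₁ cycle      = cycle
    ... | inj₂ (p , path) with pigeonhole (n<1+n h) (λ (i : Fin (suc h)) → p (toℕ i))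
    ...   | i , j , i<j , pi≡pj =
      contradiction (distinct path (≤-pred (toℕ<n i)) (≤-pred (toℕ<n j)) pi≡pj) (<⇒≢ i<j)

  nonIsolated : Fin h → Bool
  nonIsolated x = does (any? (λ y → true? (adj T x y)))

  nonIsolated⁺ : ∀ {x y} → Adj T x y → nonIsolated x ≡ true
  nonIsolated⁺ {x} {y} xy = dec-true (any? (λ y → true? (adj T x y))) (y , xy)

  module _ (forest : IsForest T) where

    -- Contrapositive of the cycle lemma for the subgraph induced on `P`. It drives the inductions
    -- that peel a forest vertex by vertex.
    ∃-endpoint : ∀ P {x} → P x ≡ true → ∃ λ x → P x ≡ true × cnt (nbrs T P x) ≤ 1
    ∃-endpoint P Px with any? (λ x → true? (P x) ×-dec (cnt (nbrs T P x) ≤? 1))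
    ... | yes found = found
    ... | no ∄x = contradiction (minDeg≥2⇒HasCycle (λ x Px → ≰⇒> (λ ≤1 → ∄x (x , Px , ≤1))) Px) forest

    -- Take an endpoint among the non-isolated vertices. It has a neighbour, and all its neighbours
    -- are non-isolated, so its degree in `T` is exactly one.
    ∃-leaf : ∀ {a b} → Adj T a b → ∃₂ λ l p → Adj T l p × (∀ {b} → Adj T l b → b ≡ p)
    ∃-leaf ab with ∃-endpoint nonIsolated (nonIsolated⁺ ab)
    ... | l , Pl , ≤1 with does⁻ (any? (λ y → true? (adj T l y))) Pl
    ...   | p , lp = l , p , lp , λ lb → cnt≤1-unique (nbrs T nonIsolated l) ≤1 (nbr lb) (nbr lp)
      where
      nbr : ∀ {y} → Adj T l y → nbrs T nonIsolated l y ≡ true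
      nbr ly = ∧⁺ (nonIsolated⁺ (Adj-sym T ly)) ly

    -- Peel off a vertex with at most one neighbour, 2-colour the rest, and put the vertex back.
    two-colouring-on : ∀ m P → cnt P ≤ m →
      Σ (Fin h → Bool) λ side → ∀ {a b} → P a ≡ true → P b ≡ true → Adj T a b → side a ≡ not (side b)
    two-colouring-on m P P≤m with any? (λ x → true? (P x))
    ... | no ∄x = (λ _ → true) , λ Pa → contradiction (_ , Pa) ∄x
    two-colouring-on zero P P≤m | yes (_ , Px) = contradiction (∃-cnt P Px) (≤⇒≯ P≤m)
    two-colouring-on (suc m) P P≤m | yes (_ , Px₀) with ∃-endpoint P Px₀
    ... | x , Px , ≤1 with two-colouring-on m (P ∖ x) (≤-pred (≤-trans (≤-reflexive (sym (cnt-∖-∈ P Px))) P≤m))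
                         | any? (λ t → true? (nbrs T P x t))
    ...   | side , proper | no ∄t = side , proper'
      where
      proper' : ∀ {a b} → P a ≡ true → P b ≡ true → Adj T a b → side a ≡ not (side b)
      proper' {a} {b} Pa Pb ab with a ≟ x | b ≟ x
      ... | yes refl | _        = contradiction (b , ∧⁺ Pb ab) ∄t
      ... | no _     | yes refl = contradiction (a , ∧⁺ Pa (Adj-sym T ab)) ∄t
      ... | no a≢x   | no b≢x   = proper (∖⁺ P Pa a≢x) (∖⁺ P Pb b≢x) ab
    ...   | side , proper | yes (t , xt) = side' , proper'
      where
      side' : Fin h → Bool
      side' z = if does (z ≟ x) then not (side t) else side z
      only-t : ∀ {b} → P b ≡ true → Adj T x b → b ≡ t
      only-t Pb xb = cnt≤1-unique (nbrs T P x) ≤1 (∧⁺ Pb xb) xt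
      proper' : ∀ {a b} → P a ≡ true → P b ≡ true → Adj T a b → side' a ≡ not (side' b)
      proper' {a} {b} Pa Pb ab with a ≟ x | b ≟ x
      ... | yes refl | yes refl = contradiction refl (Adj-irrefl T ab)
      ... | yes refl | no _     = cong (not ∘ side) (sym (only-t Pb ab))
      ... | no _     | yes refl = trans (cong side (only-t Pa (Adj-sym T ab))) (sym (not-involutive _))
      ... | no a≢x   | no b≢x   = proper (∖⁺ P Pa a≢x) (∖⁺ P Pb b≢x) ab

    two-colouring : Σ (Fin h → Bool) λ side → ∀ {a b} → Adj T a b → side a ≡ not (side b)
    two-colouring with two-colouring-on h (λ _ → true) (cnt≤n _)
    ... | side , proper = side , proper refl refl

    module _ {n d} (h≤ : h ≤ 2 + d) (G : Graph n) (Q : Fin n → Bool)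
             (minDeg : ∀ {v} → Q v ≡ true → 1 + d ≤ cnt (nbrs G Q v)) {v₀} (Qv₀ : Q v₀ ≡ true) where

      -- Count `v₀` together with its neighbours in `Q`.
      many : 2 + d ≤ cnt Q
      many = ≤-trans (s≤s (≤-trans (minDeg Qv₀) (cnt-mono nbrs⊆))) (≤-reflexive (sym (cnt-∖-∈ Q Qv₀)))
        where
        nbrs⊆ : nbrs G Q v₀ ⊆ (Q ∖ v₀)
        nbrs⊆ nbr with ∧⁻ nbr
        ... | Qv , v₀v = ∖⁺ Q Qv (Adj-irrefl G v₀v ∘ sym)

      -- A partial embedding: `ψ` is total, but its values outside `P` are unconstrained.
      record EmbedsOn (P : Fin h → Bool) : Set where
        field
          ψ     : Fin h → Fin n
          ψ-inj : ∀ {a b} → P a ≡ true → P b ≡ true → ψ a ≡ ψ b → a ≡ b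
          ψ-Q   : ∀ {a} → P a ≡ true → Q (ψ a) ≡ true
          ψ-adj : ∀ {a b} → P a ≡ true → P b ≡ true → Adj T a b → Adj G (ψ a) (ψ b)
      open EmbedsOn

      extend-embedding : ∀ {P x} (E : EmbedsOn (P ∖ x)) y → Q y ≡ true →
        (∀ {t} → (P ∖ x) t ≡ true → y ≢ ψ E t) →
        (∀ {b} → P b ≡ true → Adj T x b → Adj G y (ψ E b)) → EmbedsOn P
      extend-embedding {P} {x} E y Qy fresh adjacent = record
        { ψ = ψ' ; ψ-inj = inj' ; ψ-Q = Q' ; ψ-adj = adj' }
        where
        ψ' : Fin h → Fin n
        ψ' z = if does (z ≟ x) then y else ψ E z
        inj' : ∀ {a b} → P a ≡ true → P b ≡ true → ψ' a ≡ ψ' b → a ≡ b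
        inj' {a} {b} Pa Pb eq with a ≟ x | b ≟ x
        ... | yes refl | yes refl = refl
        ... | yes refl | no b≢x   = contradiction eq (fresh (∖⁺ P Pb b≢x))
        ... | no a≢x   | yes refl = contradiction (sym eq) (fresh (∖⁺ P Pa a≢x))
        ... | no a≢x   | no b≢x   = ψ-inj E (∖⁺ P Pa a≢x) (∖⁺ P Pb b≢x) eq
        Q' : ∀ {a} → P a ≡ true → Q (ψ' a) ≡ true
        Q' {a} Pa with a ≟ x
        ... | yes _  = Qy
        ... | no a≢x = ψ-Q E (∖⁺ P Pa a≢x)
        adj' : ∀ {a b} → P a ≡ true → P b ≡ true → Adj T a b → Adj G (ψ' a) (ψ' b)
        adj' {a} {b} Pa Pb ab with a ≟ x | b ≟ x
        ... | yes refl | yes refl = contradiction refl (Adj-irrefl T ab)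
        ... | yes refl | no _     = adjacent Pb ab
        ... | no _     | yes refl = Adj-sym G (adjacent Pa (Adj-sym T ab))
        ... | no a≢x   | no b≢x   = ψ-adj E (∖⁺ P Pa a≢x) (∖⁺ P Pb b≢x) ab

      greedy : ∀ m P → cnt P ≤ m → m ≤ 2 + d → EmbedsOn P
      greedy m P P≤m m≤ with any? (λ x → true? (P x))
      ... | no ∄x = record { ψ = λ _ → v₀ ; ψ-inj = λ Pa → contradiction (_ , Pa) ∄x
                           ; ψ-Q = λ _ → Qv₀ ; ψ-adj = λ Pa → contradiction (_ , Pa) ∄x }
      greedy zero P P≤m m≤ | yes (_ , Px) = contradiction (∃-cnt P Px) (≤⇒≯ P≤m)
      greedy (suc m) P P≤m m≤ | yes (_ , Px₀) with ∃-endpoint P Px₀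
      ... | x , Px , ≤1 = place (any? (λ t → true? (nbrs T P x t)))
        where
        cnt-rest : cnt (P ∖ x) ≤ m
        cnt-rest = ≤-pred (≤-trans (≤-reflexive (sym (cnt-∖-∈ P Px))) P≤m)
        E : EmbedsOn (P ∖ x)
        E = greedy m (P ∖ x) cnt-rest (≤-trans (n≤1+n m) m≤)
        place : Dec (∃ λ t → nbrs T P x t ≡ true) → EmbedsOn P
        place (no ∄t) with cnt-avoid m Q (P ∖ x) (ψ E) cnt-rest (≤-trans m≤ many)
        ... | y , Qy , fresh = extend-embedding {P} E y Qy fresh (λ Pb xb → contradiction (_ , ∧⁺ Pb xb) ∄t)
        place (yes (t , xt)) with ∧⁻ xt
        ... | Pt , Txt with ∖⁺ P Pt (Adj-irrefl T Txt ∘ sym)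
        -- The image of `t` is not adjacent to itself, so only the at most `d` vertices of `P` other
        -- than `x` and `t` can block one of its `1 + d` neighbours.
        ...   | P't with cnt-avoid d (nbrs G Q (ψ E t)) (P ∖ x ∖ t) (ψ E)
                       (≤-pred (≤-trans (≤-reflexive (sym (cnt-∖-∈ (P ∖ x) P't))) (≤-trans cnt-rest (≤-pred m≤))))
                       (minDeg (ψ-Q E P't))
        ...     | y , nbr , avoid with ∧⁻ nbr
        ...       | Qy , φty = extend-embedding {P} E y Qy fresh adjacent
          where
          fresh : ∀ {s} → (P ∖ x) s ≡ true → y ≢ ψ E s
          fresh {s} P's with s ≟ t
          ... | yes refl = Adj-irrefl G φty ∘ sym
          ... | no s≢t   = avoid (∖⁺ (P ∖ x) P's s≢t)
          adjacent : ∀ {b} → P b ≡ true → Adj T x b → Adj G y (ψ E b)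
          adjacent Pb xb with cnt≤1-unique (nbrs T P x) ≤1 (∧⁺ Pb xb) xt
          ... | refl = Adj-sym G φty

      minDeg⇒Embeds : Embeds T G
      minDeg⇒Embeds = ψ E , ψ-inj E refl refl , λ a b → ψ-adj E refl refl
        where
        E : EmbedsOn (λ _ → true)
        E = greedy (2 + d) (λ _ → true) (≤-trans (cnt≤n _) h≤) ≤-refl

-- Degeneracy and filling with cliques

module _ {h n d} {T : Graph h} (forest : IsForest T) (h≤ : h ≤ 2 + d) (G : Graph n) (free : Free T G) where

  private
    inside : (Fin n → Bool) → Fin n → Fin n → Bool
    inside Q u v = Q u ∧ nbrs G Q u v

  -- The ordered pairs lost with `v` lie in its row and its column, each with as many edges as `v`
  -- has neighbours in `Q`.
  e2-inside-∖ : ∀ Q v → e2 (inside Q) ≤ e2 (inside (Q ∖ v)) + 2 * cnt (nbrs G Q v)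
  e2-inside-∖ Q v = begin
    e2 (inside Q)                                                     ≤⟨ ∑-mono (λ a → ∑-mono (pointwise a)) ⟩
    ∑ (λ a → ∑ (λ b → ⟦ inside (Q ∖ v) a b ⟧ + (rowv a b + rowv b a))) ≡⟨ ∑-cong (λ a → ∑-+ _ _) ⟩
    ∑ (λ a → cnt (inside (Q ∖ v) a) + ∑ (λ b → rowv a b + rowv b a))   ≡⟨ ∑-+ _ _ ⟩
    e2 (inside (Q ∖ v)) + ∑ (λ a → ∑ (λ b → rowv a b + rowv b a))      ≡⟨ cong (e2 (inside (Q ∖ v)) +_) both ⟩
    e2 (inside (Q ∖ v)) + 2 * cnt (nbrs G Q v)                         ∎
    where
    open ≤-Reasoning
    rowv : Fin n → Fin n → ℕ
    rowv a b = ⟦ does (a ≟ v) ⟧ * ⟦ nbrs G Q v b ⟧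
    pointwise : ∀ a b → ⟦ inside Q a b ⟧ ≤ ⟦ inside (Q ∖ v) a b ⟧ + (rowv a b + rowv b a)
    pointwise a b with a ≟ v | b ≟ v
    ... | no _     | no _     with Q a | Q b | adj G a b
    ...   | true  | true  | true  = s≤s z≤n
    ...   | true  | true  | false = z≤n
    ...   | true  | false | _     = z≤n
    ...   | false | _     | _     = z≤n
    pointwise a b | yes refl | _ with nbrs G Q a b
    ...   | true  = ≤-trans (⟦⟧-mono {q = true} (λ _ → refl)) (≤-trans (m≤m+n 1 _) (m≤n+m _ ⟦ (Q a ∧ false) ∧ _ ⟧))
    ...   | false with Q a
    ...     | true  = z≤n
    ...     | false = z≤n
    pointwise a b | no _ | yes refl with Q a | Q b | adj G a b in ab
    ...   | true  | true  | true  rewrite Adj-sym G ab = s≤s z≤n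
    ...   | true  | true  | false = z≤n
    ...   | true  | false | _     = z≤n
    ...   | false | _     | _     = z≤n
    row : ∑ (λ a → ∑ (rowv a)) ≡ cnt (nbrs G Q v)
    row = trans (∑-cong (λ a → sym (∑-*ˡ ⟦ does (a ≟ v) ⟧ (λ b → ⟦ nbrs G Q v b ⟧)))) (∑-single (λ _ → cnt (nbrs G Q v)) v)
    both : ∑ (λ a → ∑ (λ b → rowv a b + rowv b a)) ≡ 2 * cnt (nbrs G Q v)
    both = trans (∑-cong (λ a → ∑-+ _ _)) (trans (∑-+ _ _)
      (cong₂ _+_ row (trans (∑-comm (λ a b → rowv b a)) (trans row (sym (+-identityʳ _))))))

  -- Delete a vertex with at most `d` neighbours in `Q`. There is one, since otherwise the greedy
  -- embedding would find `T` in `G`.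
  degenerate-bound : ∀ m Q → cnt Q ≤ m → e2 (inside Q) ≤ 2 * (d * m)
  degenerate-bound m Q Q≤m with any? (λ v → true? (Q v))
  ... | no ∄v = ≤-trans (≤-reflexive (∑-zero (λ u → ∑-zero (λ v → cong (λ q → ⟦ q ∧ nbrs G Q u v ⟧) (¬-not (∄v ∘ (u ,_))))))) z≤n
  degenerate-bound zero Q Q≤m | yes (_ , Qv) = contradiction (∃-cnt Q Qv) (≤⇒≯ Q≤m)
  degenerate-bound (suc m) Q Q≤m | yes (_ , Qv₀) with any? (λ v → true? (Q v) ×-dec (cnt (nbrs G Q v) ≤? d))
  ... | no ∄v = contradiction (minDeg⇒Embeds T forest {d = d} h≤ G Q (λ Qv → ≰⇒> (λ ≤d → ∄v (_ , Qv , ≤d))) Qv₀) free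
  ... | yes (v , Qv , ≤d) = begin
    e2 (inside Q)                                   ≤⟨ e2-inside-∖ Q v ⟩
    e2 (inside (Q ∖ v)) + 2 * cnt (nbrs G Q v)      ≤⟨ +-mono-≤ (degenerate-bound m (Q ∖ v) (≤-pred (≤-trans (≤-reflexive (sym (cnt-∖-∈ Q Qv))) Q≤m))) (*-monoʳ-≤ 2 ≤d) ⟩
    2 * (d * m) + 2 * d                             ≡⟨ arith d m ⟩
    2 * (d * suc m)                                 ∎
    where
    open ≤-Reasoning
    arith : ∀ d m → 2 * (d * m) + 2 * d ≡ 2 * (d * suc m)
    arith = solve-∀

  free⇒e2≤ : e2 (adj G) ≤ 2 * (d * n)
  free⇒e2≤ = degenerate-bound n (λ _ → true) (cnt≤n _)

module _ {n} (G : Graph n) (K : Fin n → Bool) where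

  clique : Fin n → Fin n → Bool
  clique u v = K u ∧ (K ∖ u) v

  addClique : Graph n
  addClique = record { adj = λ u v → adj G u v ∨ clique u v ; sym = symm ; irrefl = irr }
    where
    symm : ∀ u v → adj G u v ∨ clique u v ≡ adj G v u ∨ clique v u
    symm u v rewrite adj-sym G u v with u ≟ v | v ≟ u
    ... | yes refl | yes _    = refl
    ... | yes refl | no u≢u   = contradiction refl u≢u
    ... | no u≢u   | yes refl = contradiction refl u≢u
    ... | no _     | no _ with K u | K v
    ...   | true  | true  = refl
    ...   | true  | false = refl
    ...   | false | true  = refl
    ...   | false | false = refl
    irr : ∀ u → adj G u u ∨ clique u u ≡ false
    irr u rewrite irrefl G u | dec-true (u ≟ u) refl with K u
    ... | true  = refl
    ... | false = refl

  module _ (isolated : ∀ {u v} → K u ≡ true → adj G u v ≡ false) where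

    addClique-split : ∀ u v → ⟦ adj addClique u v ⟧ ≡ ⟦ adj G u v ⟧ + ⟦ clique u v ⟧
    addClique-split u v with K u in Ku
    ... | true rewrite isolated {u} {v} Ku = refl
    ... | false with adj G u v
    ...   | true  = refl
    ...   | false = refl

    e2-addClique : ∀ {d} → cnt K ≡ 1 + d → e2 (adj addClique) ≡ e2 (adj G) + d * (1 + d)
    e2-addClique {d} |K| = begin
      e2 (adj addClique)                                           ≡⟨ ∑-cong (λ u → ∑-cong (addClique-split u)) ⟩
      ∑ (λ u → ∑ (λ v → ⟦ adj G u v ⟧ + ⟦ clique u v ⟧))           ≡⟨ ∑-cong (λ u → ∑-+ _ _) ⟩
      ∑ (λ u → cnt (adj G u) + cnt (clique u))                     ≡⟨ ∑-+ _ _ ⟩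
      e2 (adj G) + ∑ (λ u → cnt (clique u))                        ≡⟨ cong (e2 (adj G) +_) (∑-cong row) ⟩
      e2 (adj G) + ∑ (λ u → d * ⟦ K u ⟧)                           ≡⟨ cong (e2 (adj G) +_) (sym (∑-*ˡ d (λ u → ⟦ K u ⟧))) ⟩
      e2 (adj G) + d * cnt K                                       ≡⟨ cong (λ m → e2 (adj G) + d * m) |K| ⟩
      e2 (adj G) + d * (1 + d)                                     ∎
      where
      open ≡-Reasoning
      row : ∀ u → cnt (clique u) ≡ d * ⟦ K u ⟧
      row u with K u in Ku
      ... | true  = trans (Data.Nat.Properties.suc-injective (trans (sym (cnt-∖-∈ K Ku)) |K|)) (sym (*-identityʳ d))
      ... | false = trans (∑-zero (λ _ → refl)) (sym (*-zeroʳ d))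

    addClique-closed : ∀ {a b} → Adj addClique a b → K a ≡ K b
    addClique-closed {a} {b} ab with K a in Ka | adj G a b in Gab
    ... | true  | true  = contradiction (isolated Ka) (true≢false Gab)
    ... | true  | false = sym (proj₁ (∧⁻ ab))
    ... | false | true  with K b in Kb
    ...   | true  = contradiction (isolated Kb) (true≢false (Adj-sym G Gab))
    ...   | false = refl

    -- No edge leaves `K`, so a copy of the connected `T` lies on the side of the image of vertex
    -- `zero`: inside `K`, which is too small, or outside, where all edges belong to `G`.
    addClique-free : ∀ {h} {T : Graph (suc h)} → Connected T → cnt K < suc h → Free T G → Free T addClique
    addClique-free {h} {T} connected |K|<h free (ψ , ψ-inj , ψ-adj) with K (ψ zero) in K₀
    ... | true  = contradiction (injective⇒≤cnt K ψ ψ-inj (λ t → trans (sym (walk-K (connected zero t))) K₀)) (<⇒≱ |K|<h)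
      where
      walk-K : ∀ {s t} → Walk T s t → K (ψ s) ≡ K (ψ t)
      walk-K here        = refl
      walk-K (step ab w) = trans (addClique-closed (ψ-adj _ _ ab)) (walk-K w)
    ... | false = free (ψ , ψ-inj , λ a b ab → in-G a (ψ-adj a b ab))
      where
      walk-K : ∀ {s t} → Walk T s t → K (ψ s) ≡ K (ψ t)
      walk-K here        = refl
      walk-K (step ab w) = trans (addClique-closed (ψ-adj _ _ ab)) (walk-K w)
      in-G : ∀ a {v} → Adj addClique (ψ a) v → Adj G (ψ a) v
      in-G a {v} av with adj G (ψ a) v
      ... | true  = refl
      ... | false = contradiction (proj₁ (∧⁻ av)) (λ Ka → true≢false Ka (trans (sym (walk-K (connected zero a))) K₀))

module _ {n d : ℕ} {T : Graph (2 + d)} (connected : Connected T) where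

  -- A clique on `1 + d` vertices of `S` adds `d * (1 + d)` ordered pairs, that is `d` per vertex,
  -- and leaves the rest of `S` isolated. The final slack pays for the fewer than `1 + d` vertices
  -- left over.
  fill-cliques : ∀ m (S : Fin n → Bool) → cnt S ≤ m → (G : Graph n) → Free T G →
    (∀ {u v} → S u ≡ true → adj G u v ≡ false) →
    Σ (Graph n) λ G' → Free T G' × e2 (adj G) + d * cnt S ≤ e2 (adj G') + d * (1 + d)
  fill-cliques m S S≤m G free isolated with 1 + d ≤? cnt S
  ... | no S≱ = G , free , +-monoʳ-≤ _ (*-monoʳ-≤ d (<⇒≤ (≰⇒> S≱)))
  fill-cliques zero S S≤m G free isolated | yes S≥ = contradiction (≤-trans S≥ S≤m) λ ()
  fill-cliques (suc m) S S≤m G free isolated | yes S≥ with cnt-subset (1 + d) S S≥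
  ... | K , K⊆S , |K| with fill-cliques m (S ─ K) (≤-pred (≤-trans (s≤s (m≤n+m _ d)) (≤-trans (≤-reflexive (sym |S|)) S≤m)))
                             (addClique G K) (addClique-free G K isolatedK connected (≤-reflexive (cong suc |K|)) free) isolated'
    where
    isolatedK : ∀ {u v} → K u ≡ true → adj G u v ≡ false
    isolatedK Ku = isolated (K⊆S Ku)
    |S| : cnt S ≡ 1 + d + cnt (S ─ K)
    |S| = trans (cnt-─ K⊆S) (cong (_+ cnt (S ─ K)) |K|)
    isolated' : ∀ {u v} → (S ─ K) u ≡ true → adj (addClique G K) u v ≡ false
    isolated' {u} {v} S'u with ∧⁻ S'u
    ... | Su , ¬Ku rewrite isolated {u} {v} Su | not⁻ ¬Ku = refl
  ...   | G' , free' , bound = G' , free' , (begin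
    e2 (adj G) + d * cnt S                          ≡⟨ cong (λ m → e2 (adj G) + d * m) (trans (cnt-─ K⊆S) (cong (_+ cnt (S ─ K)) |K|)) ⟩
    e2 (adj G) + d * (1 + d + cnt (S ─ K))          ≡⟨ arith (e2 (adj G)) d (cnt (S ─ K)) ⟩
    e2 (adj G) + d * (1 + d) + d * cnt (S ─ K)      ≡⟨ cong (_+ d * cnt (S ─ K)) (sym (e2-addClique G K (isolated ∘ K⊆S) |K|)) ⟩
    e2 (adj (addClique G K)) + d * cnt (S ─ K)      ≤⟨ bound ⟩
    e2 (adj G') + d * (1 + d)                       ∎)
    where
    open ≤-Reasoning
    arith : ∀ e d m → e + d * (1 + d + m) ≡ e + d * (1 + d) + d * m
    arith = solve-∀

-- Monochromatic complete bipartite graphs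

module _ {h n} (ψ : Fin h → Fin n) where

  infixl 6 _[_↦_]
  _[_↦_] : Fin h → Fin n → Fin h → Fin n
  _[_↦_] x y z = if does (z ≟ x) then y else ψ z

  [↦]-injective : ∀ {x y} → Injective _≡_ _≡_ ψ → (∀ z → z ≢ x → ψ z ≢ y) → Injective _≡_ _≡_ (_[_↦_] x y)
  [↦]-injective {x} ψ-inj fresh {a} {b} eq with a ≟ x | b ≟ x
  ... | yes refl | yes refl = refl
  ... | yes refl | no b≢x   = contradiction (sym eq) (fresh b b≢x)
  ... | no a≢x   | yes refl = contradiction eq (fresh a a≢x)
  ... | no _     | no _     = ψ-inj eq

module _ {h} (T : Graph h) (forest : IsForest T) where

  -- The two sides may be exchanged, so the side of one vertex can be prescribed.
  two-colouring-at : ∀ p → Σ (Fin h → Bool) λ side → side p ≡ true × (∀ {a b} → Adj T a b → side a ≡ not (side b))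
  two-colouring-at p with two-colouring T forest
  ... | side , proper with side p in sp
  ...   | true  = side , sp , proper
  ...   | false = not ∘ side , cong not sp , cong not ∘ proper

record CompleteBipartite {k n} (c : Colouring k n) (j : Fin k) (s : ℕ) (A B : Fin n → Bool) : Set where
  field
    A-size   : s ≤ cnt A
    B-size   : s ≤ cnt B
    disjoint : ∀ {v} → A v ≡ true → B v ≡ true → ⊥
    full     : ∀ {a b} → A a ≡ true → B b ≡ true → col c a b ≡ j
open CompleteBipartite

CompleteBipartite-sym : ∀ {k n} {c : Colouring k n} {j s A B} → CompleteBipartite c j s A B → CompleteBipartite c j s B A
CompleteBipartite-sym {c = c} K = record
  { A-size = B-size K ; B-size = A-size K ; disjoint = flip (disjoint K)
  ; full = λ Bb Aa → trans (col-sym c _ _) (full K Aa Bb) }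

module _ {k n h} {c : Colouring k n} {T : Graph h} (forest : IsForest T) {x y : Fin h} (xy : Adj T x y) where

  -- The edge v u becomes a leaf edge of T with leaf u, the rest of T goes into the bipartite graph.
  saturated : ∀ {j A B} → CompleteBipartite c j (2 + h) A B → ∀ {v u} → A v ≡ true → col c v u ≡ j → ¬ NIM c T v u
  saturated {j} {A} {B} K {v} {u} Av vu (v≢u , ¬copy) with ∃-leaf T forest xy
  -- The leaf `l` goes to `u` and its neighbour `p` to `v`. The other images must avoid `u` and `v`,
  -- which costs up to two vertices of `A` and one of `B`, as `v` is not in `B`; hence the part size
  -- `2 + h`.
  ... | l , p , lp , only-p with two-colouring-at T forest p
                               | ≤cnt⇒injective h (A ∖ v ∖ u) (shrink₂ (A-size K)) | ≤cnt⇒injective h (B ∖ u) (shrink (B-size K))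
    where
    shrink : ∀ {P} → 2 + h ≤ cnt P → h ≤ cnt (P ∖ u)
    shrink {P} ≥ = ≤-pred (≤-trans (n≤1+n _) (≤-trans ≥ (cnt-∖ P u)))
    shrink₂ : ∀ {P} → 2 + h ≤ cnt P → h ≤ cnt (P ∖ v ∖ u)
    shrink₂ {P} ≥ = ≤-pred (≤-pred (≤-trans ≥ (≤-trans (cnt-∖ P v) (s≤s (cnt-∖ (P ∖ v) u)))))
  ...   | side , side-p , proper | f , f-inj , f∈ | g , g-inj , g∈ =
    ¬copy (record { colour = j ; φ = ψ ; φ-inj = ψ-inj ; mono = ψ-mono })
      (p , l , Adj-sym T lp , ψp , ψl)
    where
    l≢p : l ≢ p
    l≢p = Adj-irrefl T lp

    rest : Fin h → Fin n
    rest t = if side t then f t else g t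

    ψ : Fin h → Fin n
    ψ = (rest [ p ↦ v ]) [ l ↦ u ]

    f∈A : ∀ t → A (f t) ≡ true
    f∈A t = proj₁ (∖⁻ A (proj₁ (∖⁻ (A ∖ v) (f∈ t))))
    g∈B : ∀ t → B (g t) ≡ true
    g∈B t = proj₁ (∖⁻ B (g∈ t))

    rest-inj : Injective _≡_ _≡_ rest
    rest-inj {a} {b} eq with side a | side b
    ... | true  | true  = f-inj eq
    ... | true  | false = ⊥-elim (disjoint K (f∈A a) (trans (cong B eq) (g∈B b)))
    ... | false | true  = ⊥-elim (disjoint K (f∈A b) (trans (cong B (sym eq)) (g∈B a)))
    ... | false | false = g-inj eq

    rest≢v : ∀ t → rest t ≢ v
    rest≢v t with side t
    ... | true  = proj₂ (∖⁻ A (proj₁ (∖⁻ (A ∖ v) (f∈ t))))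
    ... | false = λ gt≡v → disjoint K Av (trans (cong B (sym gt≡v)) (g∈B t))

    rest≢u : ∀ t → rest t ≢ u
    rest≢u t with side t
    ... | true  = proj₂ (∖⁻ (A ∖ v) (f∈ t))
    ... | false = proj₂ (∖⁻ B (g∈ t))

    ψ-inj : Injective _≡_ _≡_ ψ
    ψ-inj = [↦]-injective (rest [ p ↦ v ]) ([↦]-injective rest rest-inj (λ t _ → rest≢v t)) (λ t _ → fresh t)
      where
      fresh : ∀ t → (rest [ p ↦ v ]) t ≢ u
      fresh t with t ≟ p
      ... | yes _ = v≢u
      ... | no _  = rest≢u t

    ψl : ψ l ≡ u
    ψl rewrite dec-true (l ≟ l) refl = refl
    ψp : ψ p ≡ v
    ψp rewrite dec-false (p ≟ l) (l≢p ∘ sym) | dec-true (p ≟ p) refl = refl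

    from-p : ∀ {b} → Adj T p b → col c v (rest b) ≡ j
    from-p {b} pb with side b | trans (sym side-p) (proper pb)
    ... | false | _ = full K Av (g∈B b)
    ... | true  | ()

    within : ∀ {a b} → Adj T a b → col c (rest a) (rest b) ≡ j
    within {a} {b} ab with side a | side b | proper ab
    ... | true  | false | _ = full K (f∈A a) (g∈B b)
    ... | false | true  | _ = trans (col-sym c _ _) (full K (f∈A b) (g∈B a))
    ... | true  | true  | ()
    ... | false | false | ()

    ψ-mono : ∀ a b → Adj T a b → col c (ψ a) (ψ b) ≡ j
    ψ-mono a b ab with a ≟ l | b ≟ l
    ... | yes refl | yes refl = contradiction refl (Adj-irrefl T ab)
    ... | yes refl | no _     rewrite only-p ab | dec-true (p ≟ p) refl = trans (col-sym c u v) vu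
    ... | no _     | yes refl rewrite only-p (Adj-sym T ab) | dec-true (p ≟ p) refl = vu
    ... | no _     | no _ with a ≟ p | b ≟ p
    ...   | yes refl | yes refl = contradiction refl (Adj-irrefl T ab)
    ...   | yes refl | no _     = from-p ab
    ...   | no _     | yes refl = trans (col-sym c _ _) (from-p (Adj-sym T ab))
    ...   | no _     | no _     = within ab

-- The bipartite Ramsey theorem

opaque
  -- The first summand is the number of vertices picked in `W`, which `U` may lose. The second is
  -- what `U` needs to retain `s` vertices after one pigeonhole step for each picked vertex.
  ramseySize : ℕ → ℕ → ℕ
  ramseySize k s = suc k * s + suc k ^ (suc k * s) * s

  ramseySize-≡ : ∀ k s → ramseySize k s ≡ suc k * s + suc k ^ (suc k * s) * s
  ramseySize-≡ k s = refl

ramseySize-≥ : ∀ k s → suc k * s ≤ ramseySize k s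
ramseySize-≥ k s = ≤-trans (m≤m+n _ _) (≤-reflexive (sym (ramseySize-≡ k s)))

module _ {k n} (c : Colouring (suc k) n) where

  -- The colours towards `f zero`, then towards the next vertices, are made constant one after
  -- another, each time keeping a share of at least `1 / suc k` of the current set.
  common-colours : ∀ {m} (f : Fin m → Fin n) (U : Fin n → Bool) s → suc k ^ m * s ≤ cnt U →
    Σ (Fin m → Fin (suc k)) λ χ → Σ (Fin n → Bool) λ B →
      (B ⊆ U) × s ≤ cnt B × (∀ a {b} → B b ≡ true → χ a ≡ col c (f a) b)
  common-colours {zero}  f U s U≥ = (λ ()) , U , id , ≤-trans (≤-reflexive (sym (+-identityʳ s))) U≥ , λ ()
  common-colours {suc m} f U s U≥
    with cnt-pigeonhole (col c (f zero)) U (suc k ^ m * s) (≤-trans (≤-reflexive (sym (*-assoc (suc k) (suc k ^ m) s))) U≥)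
  ... | j , Uj≥ with common-colours (f ∘ suc) (λ v → U v ∧ does (j ≟ col c (f zero) v)) s Uj≥
  ...   | χ , B , B⊆ , B≥ , χ-col = χ' , B , proj₁ ∘ ∧⁻ ∘ B⊆ , B≥ , χ'-col
    where
    χ' : Fin (suc m) → Fin (suc k)
    χ' zero    = j
    χ' (suc a) = χ a
    χ'-col : ∀ a {b} → B b ≡ true → χ' a ≡ col c (f a) b
    χ'-col zero    {b} Bb = does⁻ (j ≟ col c (f zero) b) (proj₂ (∧⁻ (B⊆ Bb)))
    χ'-col (suc a) Bb = χ-col a Bb

  -- Pick `suc k * s` vertices of `W` and find `s` other vertices of `U` towards which each picked
  -- vertex has a constant colour. By the pigeonhole principle `s` of the picked vertices share that
  -- colour.
  bipartite-Ramsey : ∀ s (W U : Fin n → Bool) → ramseySize k s ≤ cnt W → ramseySize k s ≤ cnt U →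
    Σ (Fin (suc k)) λ j → ∃₂ λ A B → CompleteBipartite c j s A B × (A ⊆ W) × (B ⊆ U)
  bipartite-Ramsey s W U W≥ U≥ with ≤cnt⇒injective (suc k * s) W (≤-trans (ramseySize-≥ k s) W≥)
  ... | f , f-inj , f∈ with common-colours f U' s (+-cancelˡ-≤ (suc k * s) _ _ (≤-trans (≤-reflexive (sym (ramseySize-≡ k s))) (≤-trans U≥ |U|)))
    where
    U' : Fin n → Bool
    U' v = U v ∧ not (does (any? (λ a → f a ≟ v)))
    |U| : cnt U ≤ suc k * s + cnt U'
    |U| = begin
      cnt U                                                            ≤⟨ ∑-mono pointwise ⟩
      ∑ (λ v → ∑ (λ a → ⟦ does (v ≟ f a) ⟧) + ⟦ U' v ⟧)                ≡⟨ ∑-+ _ _ ⟩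
      ∑ (λ v → ∑ (λ a → ⟦ does (v ≟ f a) ⟧)) + cnt U'                  ≡⟨ cong (_+ cnt U') (∑-comm (λ v a → ⟦ does (v ≟ f a) ⟧)) ⟩
      ∑ (λ a → ∑ (λ v → ⟦ does (v ≟ f a) ⟧)) + cnt U'                  ≡⟨ cong (_+ cnt U') (∑-cong (∑-≟ ∘ f)) ⟩
      ∑ {suc k * s} (λ _ → 1) + cnt U'                                 ≡⟨ cong (_+ cnt U') (trans (∑-const _ 1) (*-identityʳ _)) ⟩
      suc k * s + cnt U'                                               ∎
      where
      open ≤-Reasoning
      pointwise : ∀ v → ⟦ U v ⟧ ≤ ∑ (λ a → ⟦ does (v ≟ f a) ⟧) + ⟦ U' v ⟧
      pointwise v with U v | any? (λ a → f a ≟ v)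
      ... | false | _              = z≤n
      ... | true  | no _           = m≤n+m 1 _
      ... | true  | yes (a , refl) = ≤-trans (≤-reflexive (sym (cong ⟦_⟧ (dec-true (f a ≟ f a) refl))))
              (≤-trans (term≤∑ (λ b → ⟦ does (f a ≟ f b) ⟧) a) (m≤m+n _ _))
  ...   | χ , B , B⊆U' , B≥ , χ-col with cnt-pigeonhole χ (λ _ → true) s (≤-reflexive (sym (cnt-true (λ _ → refl))))
  ...     | j , χj≥ with ≤cnt⇒injective s (λ a → does (j ≟ χ a)) χj≥
  ...       | g , g-inj , g∈ = j , A , B , K , A⊆W , proj₁ ∘ ∧⁻ ∘ B⊆U'
    where
    A : Fin n → Bool
    A v = does (any? (λ a → f (g a) ≟ v))
    A⁻ : ∀ {v} → A v ≡ true → ∃ λ a → f (g a) ≡ v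
    A⁻ {v} = does⁻ (any? (λ a → f (g a) ≟ v))
    A⊆W : A ⊆ W
    A⊆W Av with A⁻ Av
    ... | a , refl = f∈ (g a)
    K : CompleteBipartite c j s A B
    K = record
      { A-size = injective⇒≤cnt A (f ∘ g) (g-inj ∘ f-inj) (λ a → dec-true (any? (λ b → f (g b) ≟ f (g a))) (a , refl))
      ; B-size = B≥
      ; disjoint = disj
      ; full = λ Aa Bb → fullAB (A⁻ Aa) Bb }
      where
      disj : ∀ {v} → A v ≡ true → B v ≡ true → ⊥
      disj {v} Av Bv with A⁻ Av
      ... | a , fga≡v = true≢false (dec-true (any? (λ a → f a ≟ v)) (g a , fga≡v)) (not⁻ (proj₂ (∧⁻ (B⊆U' Bv))))
      fullAB : ∀ {v b} → (∃ λ a → f (g a) ≡ v) → B b ≡ true → col c v b ≡ j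
      fullAB (a , refl) Bb = trans (sym (χ-col (g a) Bb)) (sym (does⁻ (j ≟ χ (g a)) (g∈ a)))

-- The upper bound

e2-support : ∀ {n} (b : Fin n → Fin n → Bool) (Z : Fin n → Bool) →
  (∀ {u v} → b u v ≡ true → Z u ≡ true × Z v ≡ true) → e2 b ≤ cnt Z * cnt Z
e2-support b Z b⇒Z = begin
  e2 b                          ≤⟨ ∑-mono row ⟩
  ∑ (λ u → cnt Z * ⟦ Z u ⟧)     ≡⟨ sym (∑-*ˡ (cnt Z) (λ u → ⟦ Z u ⟧)) ⟩
  cnt Z * cnt Z                 ∎
  where
  open ≤-Reasoning
  row : ∀ u → cnt (b u) ≤ cnt Z * ⟦ Z u ⟧
  row u with Z u in Zu
  ... | true  = ≤-trans (cnt-mono {P = b u} {Z} (proj₂ ∘ b⇒Z)) (≤-reflexive (sym (*-identityʳ _)))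
  ... | false = ≤-trans (≤-reflexive (∑-zero (λ v → cong ⟦_⟧ (¬-not (λ buv → true≢false (proj₁ (b⇒Z buv)) Zu))))) z≤n

-- On the doubled scale of `e2`: the first summand covers a large `W i` and the case of two colours,
-- the second the case of a tree.
upperSlack : ℕ → ℕ → ℕ → ℕ
upperSlack k h d = 2 * (R * R) + (suc k * (d * (1 + d)) + d * (2 * (suc k * R)))
  where
  R : ℕ
  R = ramseySize k (2 + h)

module UpperBound {k n h} {T : Graph h} (forest : IsForest T) {x y : Fin h} (xy : Adj T x y)
  (c : Colouring (suc k) n) (D : ∀ u v → Dec (NIM c T u v))
  {E : ℕ} (E-bound : (G : Graph n) → Free T G → e2 (adj G) ≤ E) where

  R : ℕ
  R = ramseySize k (2 + h)

  nimIn : Fin (suc k) → Fin n → Fin n → Bool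
  nimIn i u v = nim D u v ∧ does (i ≟ col c u v)

  nimIn⁻ : ∀ {i u v} → nimIn i u v ≡ true → NIM c T u v × i ≡ col c u v
  nimIn⁻ {i} {u} {v} p with ∧⁻ p
  ... | nuv , i≡ = nim⁻ D nuv , does⁻ (i ≟ col c u v) i≡

  nimGraph : Fin (suc k) → Graph n
  nimGraph i = record
    { adj    = nimIn i
    ; sym    = λ u v → cong₂ (λ p j → p ∧ does (i ≟ j)) (nim-sym D u v) (col-sym c u v)
    ; irrefl = λ u → cong (_∧ does (i ≟ col c u u)) (nim-irrefl D u) }

  -- A copy of `T` here would be monochromatic, yet the image of its edge `x y` is a NIM-edge.
  nimGraph-free : ∀ i → Free T (nimGraph i)
  nimGraph-free i (ψ , ψ-inj , ψ-adj) = proj₂ (proj₁ (nimIn⁻ {i} (ψ-adj x y xy)))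
    (record { colour = i ; φ = ψ ; φ-inj = ψ-inj ; mono = λ a b ab → sym (proj₂ (nimIn⁻ {i} (ψ-adj a b ab))) })
    (x , y , xy , refl , refl)

  nimIn≤E : ∀ i → e2 (nimIn i) ≤ E
  nimIn≤E i = E-bound (nimGraph i) (nimGraph-free i)

  ∑-nimIn : ∑ (λ i → e2 (nimIn i)) ≡ e2 (nim D)
  ∑-nimIn = trans (∑-comm _) (∑-cong (λ u → cnt-fibre (col c u) (nim D u)))

  Z : Fin (suc k) → Fin n → Bool
  Z i v = does (any? (λ u → true? (nimIn i v u)))

  Z⁺ : ∀ {i u v} → nimIn i u v ≡ true → Z i u ≡ true × Z i v ≡ true
  Z⁺ {i} {u} {v} p = dec-true (any? (λ w → true? (nimIn i u w))) (v , p) ,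
    dec-true (any? (λ w → true? (nimIn i v w))) (u , Adj-sym (nimGraph i) p)

  W : Fin (suc k) → Fin n → Bool
  W i v = does (all? (λ j → ¬? (j ≟ i) →-dec true? (Z j v)))

  W⁻ : ∀ {i v} → W i v ≡ true → ∀ j → j ≢ i → Z j v ≡ true
  W⁻ {i} {v} = does⁻ (all? (λ j → ¬? (j ≟ i) →-dec true? (Z j v)))

  W⁺ : ∀ {i v} → (∀ j → j ≢ i → Z j v ≡ true) → W i v ≡ true
  W⁺ {i} {v} = dec-true (all? (λ j → ¬? (j ≟ i) →-dec true? (Z j v)))

  saturated-Z : ∀ {j A B} → CompleteBipartite c j (2 + h) A B → ∀ {v} → A v ≡ true → ¬ Z j v ≡ true
  saturated-Z {j} K {v} Av Zjv with does⁻ (any? (λ u → true? (nimIn j v u))) Zjv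
  ... | u , p with nimIn⁻ {j} p
  ...   | vu , j≡ = saturated forest xy K Av (sym j≡) vu

  -- A large bipartite graph of colour j between W i and Z i contradicts Z i if j = i, and W i otherwise.
  W-or-Z-small : ∀ i → R ≤ cnt (W i) → cnt (Z i) < R
  W-or-Z-small i W≥ = ≰⇒> λ Z≥ → clash (bipartite-Ramsey c (2 + h) (W i) (Z i) W≥ Z≥)
    where
    clash : ¬ (Σ (Fin (suc k)) λ j → ∃₂ λ A B → CompleteBipartite c j (2 + h) A B × (A ⊆ W i) × (B ⊆ Z i))
    clash (j , A , B , K , A⊆W , B⊆Z) with j ≟ i
    ... | yes refl with cnt-∃ B (≤-trans (s≤s z≤n) (CompleteBipartite.B-size K))
    ...   | b , Bb = saturated-Z (CompleteBipartite-sym K) Bb (B⊆Z Bb)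
    clash (j , A , B , K , A⊆W , B⊆Z) | no j≢i with cnt-∃ A (≤-trans (s≤s z≤n) (CompleteBipartite.A-size K))
    ...   | a , Aa = saturated-Z K Aa (W⁻ (A⊆W Aa) j j≢i)

  nimIn≤R² : ∀ i → cnt (Z i) ≤ R → e2 (nimIn i) ≤ R * R
  nimIn≤R² i Z≤ = ≤-trans (e2-support (nimIn i) (Z i) (Z⁺ {i})) (*-mono-≤ Z≤ Z≤)

  some-W-large : ∀ i → R ≤ cnt (W i) → e2 (nim D) ≤ k * E + R * R
  some-W-large i W≥ = begin
    e2 (nim D)                                                 ≡⟨ sym ∑-nimIn ⟩
    ∑ (λ i → e2 (nimIn i))                                     ≡⟨ ∑-remove _ i ⟩
    e2 (nimIn i) + ∑ (λ j → e2 (nimIn (punchIn i j)))          ≤⟨ +-mono-≤ (nimIn≤R² i (<⇒≤ (W-or-Z-small i W≥))) (∑≤const (nimIn≤E ∘ punchIn i)) ⟩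
    R * R + k * E                                              ≡⟨ +-comm (R * R) (k * E) ⟩
    k * E + R * R                                              ∎
    where open ≤-Reasoning

  module _ (W-small : ∀ i → cnt (W i) ≤ R) where

    -- With two colours, lying in `W` of one colour means lying in `Z` of the other, so both `Z i`
    -- are small.
    two-colours-W-small : k ≡ 1 → e2 (nim D) ≤ 2 * (R * R)
    two-colours-W-small refl = begin
      e2 (nim D)              ≡⟨ sym ∑-nimIn ⟩
      ∑ (λ i → e2 (nimIn i))  ≤⟨ ∑≤const (λ i → nimIn≤R² i (Z≤R i)) ⟩
      2 * (R * R)             ∎
      where
      open ≤-Reasoning
      Z≤R : ∀ i → cnt (Z i) ≤ R
      Z≤R zero       = ≤-trans (cnt-mono {Q = W (suc zero)} (λ Zv → W⁺ λ { zero _ → Zv ; (suc zero) 1≢1 → contradiction refl 1≢1 })) (W-small (suc zero))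
      Z≤R (suc zero) = ≤-trans (cnt-mono {Q = W zero} (λ Zv → W⁺ λ { zero 0≢0 → contradiction refl 0≢0 ; (suc zero) _ → Zv })) (W-small zero)

    ∁Z : Fin (suc k) → Fin n → Bool
    ∁Z i v = not (Z i v)

    -- Each vertex is outside at least two of the `Z i` or belongs to some `W i`; weight two on the
    -- latter makes every vertex contribute at least two.
    many-missing : n * 2 ≤ ∑ (λ i → cnt (∁Z i)) + 2 * (suc k * R)
    many-missing = begin
      n * 2                                                          ≤⟨ const≤∑ pointwise ⟩
      ∑ (λ v → ∑ (λ i → ⟦ ∁Z i v ⟧) + 2 * ∑ (λ i → ⟦ W i v ⟧))       ≡⟨ ∑-+ _ _ ⟩
      ∑ (λ v → ∑ (λ i → ⟦ ∁Z i v ⟧)) + ∑ (λ v → 2 * ∑ (λ i → ⟦ W i v ⟧))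
        ≡⟨ cong₂ _+_ (∑-comm (λ v i → ⟦ ∁Z i v ⟧)) (trans (sym (∑-*ˡ 2 (λ v → ∑ (λ i → ⟦ W i v ⟧)))) (cong (2 *_) (∑-comm (λ v i → ⟦ W i v ⟧)))) ⟩
      ∑ (λ i → cnt (∁Z i)) + 2 * ∑ (λ i → cnt (W i))                 ≤⟨ +-monoʳ-≤ (∑ (λ i → cnt (∁Z i))) (*-monoʳ-≤ 2 (∑≤const W-small)) ⟩
      ∑ (λ i → cnt (∁Z i)) + 2 * (suc k * R)                         ∎
      where
      open ≤-Reasoning
      W-at : ∀ v → cnt (λ i → ∁Z i v) ≤ 1 → ∃ λ i → W i v ≡ true
      W-at v ≤1 with any? (λ i → true? (∁Z i v))
      -- A vertex in every `Z i` belongs to every `W i`; the index `zero` is an arbitrary choice.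
      ... | no ∄i = zero , W⁺ {zero} (λ j _ → not-false (∄i ∘ (j ,_)))
        where
        not-false : ∀ {b} → ¬ not b ≡ true → b ≡ true
        not-false {true}  _ = refl
        not-false {false} p = contradiction refl p
      ... | yes (i , ¬Zi) = i , W⁺ others
        where
        others : ∀ j → j ≢ i → Z j v ≡ true
        others j j≢i with Z j v in Zj
        ... | true  = refl
        ... | false = contradiction (cnt≤1-unique (λ i → ∁Z i v) ≤1 (cong not Zj) ¬Zi) j≢i
      pointwise : ∀ v → 2 ≤ ∑ (λ i → ⟦ ∁Z i v ⟧) + 2 * ∑ (λ i → ⟦ W i v ⟧)
      pointwise v with 2 ≤? cnt (λ i → ∁Z i v)
      ... | yes 2≤ = ≤-trans 2≤ (m≤m+n _ _)
      ... | no ≱2 with W-at v (≤-pred (≰⇒> ≱2))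
      ...   | i , Wi = ≤-trans (*-monoʳ-≤ 2 (∃-cnt (λ i → W i v) Wi)) (m≤n+m _ (cnt (λ i → ∁Z i v)))

    -- All `suc k` colours together may reach `suc k * E`, one `E` too many. Filling saves `d` per
    -- vertex outside each `Z i`, about `2 * (d * n)` in all, which is at least `E`; hence `E` is
    -- added to both sides and cancelled.
    tree-W-small : ∀ {d} → h ≡ 2 + d → Connected T → E ≤ 2 * (d * n) →
      e2 (nim D) ≤ k * E + (suc k * (d * (1 + d)) + d * (2 * (suc k * R)))
    tree-W-small {d} refl connected E≤ = +-cancelʳ-≤ E _ _ (begin
      e2 (nim D) + E                                                          ≤⟨ +-monoʳ-≤ _ E≤ ⟩
      e2 (nim D) + 2 * (d * n)                                                ≡⟨ arith₁ (e2 (nim D)) d n ⟩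
      e2 (nim D) + d * (n * 2)                                                ≤⟨ +-monoʳ-≤ (e2 (nim D)) (*-monoʳ-≤ d many-missing) ⟩
      e2 (nim D) + d * (∑ (λ i → cnt (∁Z i)) + r)                             ≡⟨ arith₂ (e2 (nim D)) d (∑ (λ i → cnt (∁Z i))) r ⟩
      (e2 (nim D) + d * ∑ (λ i → cnt (∁Z i))) + d * r                         ≡⟨ cong (_+ d * r) (cong₂ _+_ (sym ∑-nimIn) (∑-*ˡ d (λ i → cnt (∁Z i)))) ⟩
      (∑ (λ i → e2 (nimIn i)) + ∑ (λ i → d * cnt (∁Z i))) + d * r             ≡⟨ cong (_+ d * r) (sym (∑-+ _ _)) ⟩
      ∑ (λ i → e2 (nimIn i) + d * cnt (∁Z i)) + d * r                         ≤⟨ +-monoˡ-≤ (d * r) (∑≤const filled) ⟩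
      suc k * (E + d * (1 + d)) + d * r                                       ≡⟨ arith₃ k E (d * (1 + d)) (d * r) ⟩
      k * E + (suc k * (d * (1 + d)) + d * r) + E                             ∎)
      where
      open ≤-Reasoning
      r : ℕ
      r = 2 * (suc k * R)
      arith₁ : ∀ a d n → a + 2 * (d * n) ≡ a + d * (n * 2)
      arith₁ = solve-∀
      arith₂ : ∀ a d s r → a + d * (s + r) ≡ (a + d * s) + d * r
      arith₂ = solve-∀
      arith₃ : ∀ k E q r → suc k * (E + q) + r ≡ k * E + (suc k * q + r) + E
      arith₃ = solve-∀
      filled : ∀ i → e2 (nimIn i) + d * cnt (∁Z i) ≤ E + d * (1 + d)
      filled i with fill-cliques connected n (∁Z i) (cnt≤n _) (nimGraph i) (nimGraph-free i)
                      (λ ¬Zu → ¬-not (λ uv → true≢false (proj₁ (Z⁺ {i} uv)) (not⁻ ¬Zu)))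
      ... | G' , free' , bound = ≤-trans bound (+-monoˡ-≤ _ (E-bound G' free'))

  upper-bound : ∀ {d} → h ≡ 2 + d → suc k ≡ 2 ⊎ IsTree T → E ≤ 2 * (d * n) → e2 (nim D) ≤ k * E + upperSlack k h d
  upper-bound {d} h≡ cases E≤ with any? (λ i → R ≤? cnt (W i)) | cases
  ... | yes (i , W≥) | _ = ≤-trans (some-W-large i W≥) (+-monoʳ-≤ (k * E) (≤-trans (m≤m+n (R * R) _) (m≤m+n _ _)))
  ... | no ∄i | inj₁ k≡2 =
    ≤-trans (two-colours-W-small (λ i → <⇒≤ (≰⇒> (∄i ∘ (i ,_)))) (Data.Nat.Properties.suc-injective k≡2))
      (≤-trans (m≤m+n _ _) (m≤n+m _ (k * E)))
  ... | no ∄i | inj₂ (connected , _) =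
    ≤-trans (tree-W-small (λ i → <⇒≤ (≰⇒> (∄i ∘ (i ,_)))) h≡ connected E≤)
      (+-monoʳ-≤ (k * E) (m≤n+m _ (2 * (R * R))))

-- Averaging over permutations

insert : ∀ {n} → Fin (suc n) → (Fin n → Fin n) → Fin (suc n) → Fin (suc n)
insert x π zero    = x
insert x π (suc u) = punchIn x (π u)

-- The sum of f π over all permutations π, which are enumerated by repeated insertion.
∑π : ∀ n → ((Fin n → Fin n) → ℕ) → ℕ
∑π zero    f = f (λ ())
∑π (suc n) f = ∑ (λ x → ∑π n (λ π → f (insert x π)))

∑π-∑ : ∀ n {m} (f : Fin m → (Fin n → Fin n) → ℕ) → ∑π n (λ π → ∑ (λ i → f i π)) ≡ ∑ (λ i → ∑π n (f i))
∑π-∑ zero    f = refl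
∑π-∑ (suc n) f = trans (∑-cong (λ x → ∑π-∑ n (λ i π → f i (insert x π)))) (∑-comm (λ x i → ∑π n (λ π → f i (insert x π))))

∑π-const : ∀ n c → ∑π n (λ _ → c) ≡ n ! * c
∑π-const zero    c = sym (*-identityˡ c)
∑π-const (suc n) c = trans (∑-cong {suc n} (λ x → ∑π-const n c)) (trans (∑-const (suc n) (n ! * c)) (sym (*-assoc (suc n) (n !) c)))

-- Bijectivity in the two forms used: injectivity transports copies, and invariance of sums counts
-- the edges of a permuted graph.
record IsPerm {n} (π : Fin n → Fin n) : Set where
  field
    injective : Injective _≡_ _≡_ π
    reindex   : ∀ f → ∑ (f ∘ π) ≡ ∑ f
open IsPerm

insert-IsPerm : ∀ {n} x {π : Fin n → Fin n} → IsPerm π → IsPerm (insert x π)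
insert-IsPerm {n} x {π} p = record { injective = inj ; reindex = re }
  where
  inj : Injective _≡_ _≡_ (insert x π)
  inj {zero}  {zero}  _  = refl
  inj {zero}  {suc v} eq = contradiction (sym eq) (punchInᵢ≢i x _)
  inj {suc u} {zero}  eq = contradiction eq (punchInᵢ≢i x _)
  inj {suc u} {suc v} eq = cong suc (injective p (punchIn-injective x _ _ eq))
  re : ∀ f → ∑ (f ∘ insert x π) ≡ ∑ f
  re f = begin
    ∑ (f ∘ insert x π)                      ≡⟨ ∑-suc _ ⟩
    f x + ∑ (λ u → f (punchIn x (π u)))     ≡⟨ cong (f x +_) (reindex p (f ∘ punchIn x)) ⟩
    f x + ∑ (f ∘ punchIn x)                 ≡⟨ sym (∑-remove f x) ⟩
    ∑ f                                     ∎
    where open ≡-Reasoning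

-- Method of conditional expectations: choose the image `x` of `zero` with the least partial sum,
-- then recurse.
∃-below-average : ∀ n (f : (Fin n → Fin n) → ℕ) → ∃ λ π → IsPerm π × n ! * f π ≤ ∑π n f
∃-below-average zero    f = (λ ()) , record { injective = λ { {()} } ; reindex = λ g → trans (∑-empty _) (sym (∑-empty g)) } ,
  ≤-reflexive (*-identityˡ _)
∃-below-average (suc n) f with ∑-min (λ x → ∑π n (λ π → f (insert x π)))
... | x , x-min with ∃-below-average n (λ π → f (insert x π))
...   | π , perm , bound = insert x π , insert-IsPerm x perm , (begin
  suc n * n ! * f (insert x π)                  ≡⟨ *-assoc (suc n) (n !) _ ⟩
  suc n * (n ! * f (insert x π))                ≤⟨ *-monoʳ-≤ (suc n) bound ⟩
  suc n * ∑π n (λ π → f (insert x π))           ≤⟨ x-min ⟩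
  ∑π (suc n) f                                  ∎)
  where open ≤-Reasoning

-- Each value of `w` is skipped for exactly one `z`.
∑-punchIn : ∀ {n} (w : Fin (suc n) → ℕ) → ∑ (λ z → ∑ (w ∘ punchIn z)) ≡ n * ∑ w
∑-punchIn {n} w = +-cancelˡ-≡ (∑ w) _ _ (begin
  ∑ w + ∑ (λ z → ∑ (w ∘ punchIn z))         ≡⟨ sym (∑-+ _ _) ⟩
  ∑ (λ z → w z + ∑ (w ∘ punchIn z))         ≡⟨ ∑-cong (λ z → sym (∑-remove w z)) ⟩
  ∑ {suc n} (λ _ → ∑ w)                     ≡⟨ ∑-const (suc n) (∑ w) ⟩
  ∑ w + n * ∑ w                             ∎)
  where open ≡-Reasoning

-- Exactly `n !` permutations send `u` to a given point. If `u` is not `zero`, condition on the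
-- image `z` of `zero`.
∑π-point : ∀ n (w : Fin (suc n) → ℕ) u → ∑π (suc n) (λ π → w (π u)) ≡ n ! * ∑ w
∑π-point n w zero = trans (∑-cong (λ x → ∑π-const n (w x))) (sym (∑-*ˡ (n !) w))
∑π-point (suc n) w (suc u) = begin
  ∑ (λ z → ∑π (suc n) (λ π → w (punchIn z (π u))))     ≡⟨ ∑-cong (λ z → ∑π-point n (w ∘ punchIn z) u) ⟩
  ∑ (λ z → n ! * ∑ (w ∘ punchIn z))                    ≡⟨ sym (∑-*ˡ (n !) (λ z → ∑ (w ∘ punchIn z))) ⟩
  n ! * ∑ (λ z → ∑ (w ∘ punchIn z))                    ≡⟨ cong (n ! *_) (∑-punchIn w) ⟩
  n ! * (suc n * ∑ w)                                  ≡⟨ arith (n !) (suc n) (∑ w) ⟩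
  suc n * n ! * ∑ w                                    ∎
  where
  open ≡-Reasoning
  arith : ∀ a b c → a * (b * c) ≡ b * a * c
  arith = solve-∀

module _ where
  open ≡-Reasoning

  -- The full sum splits into row `z`, column `z` and the rest; row and column meet only in a
  -- diagonal entry, which vanishes.
  ∑∑-punchIn : ∀ {n} (w : Fin (suc n) → Fin (suc n) → ℕ) → (∀ z → w z z ≡ 0) → ∀ z →
    ∑ (w z) + ∑ (λ x → w x z) + ∑ (λ x → ∑ (λ y → w (punchIn z x) (punchIn z y))) ≡ ∑ (λ x → ∑ (w x))
  ∑∑-punchIn w w-diag z = begin
    ∑ (w z) + ∑ (λ x → w x z) + rest
      ≡⟨ cong (λ m → ∑ (w z) + m + rest) (trans (∑-remove (λ x → w x z) z) (cong (_+ ∑ (λ x → w (punchIn z x) z)) (w-diag z))) ⟩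
    ∑ (w z) + ∑ (λ x → w (punchIn z x) z) + rest
      ≡⟨ +-assoc (∑ (w z)) _ rest ⟩
    ∑ (w z) + (∑ (λ x → w (punchIn z x) z) + rest)
      ≡⟨ cong (∑ (w z) +_) (sym (∑-+ _ _)) ⟩
    ∑ (w z) + ∑ (λ x → w (punchIn z x) z + ∑ (λ y → w (punchIn z x) (punchIn z y)))
      ≡⟨ cong (∑ (w z) +_) (∑-cong (λ x → sym (∑-remove (w (punchIn z x)) z))) ⟩
    ∑ (w z) + ∑ (λ x → ∑ (w (punchIn z x)))
      ≡⟨ sym (∑-remove (λ x → ∑ (w x)) z) ⟩
    ∑ (λ x → ∑ (w x)) ∎
    where
    rest : ℕ
    rest = ∑ (λ x → ∑ (λ y → w (punchIn z x) (punchIn z y)))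

  -- A pair x ≠ y avoids n of the n + 2 points z.
  ∑∑∑-punchIn : ∀ {n} (w : Fin (2 + n) → Fin (2 + n) → ℕ) → (∀ z → w z z ≡ 0) →
    ∑ (λ z → ∑ (λ x → ∑ (λ y → w (punchIn z x) (punchIn z y)))) ≡ n * ∑ (λ x → ∑ (w x))
  ∑∑∑-punchIn {n} w w-diag = +-cancelˡ-≡ (S + S) _ _ (begin
    S + S + ∑ rest                                                         ≡⟨ cong (λ m → S + m + ∑ rest) (∑-comm w) ⟩
    S + ∑ (λ z → ∑ (λ x → w x z)) + ∑ rest                                 ≡⟨ cong (_+ ∑ rest) (sym (∑-+ _ _)) ⟩
    ∑ (λ z → ∑ (w z) + ∑ (λ x → w x z)) + ∑ rest                           ≡⟨ sym (∑-+ _ _) ⟩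
    ∑ (λ z → ∑ (w z) + ∑ (λ x → w x z) + rest z)                           ≡⟨ ∑-cong (∑∑-punchIn w w-diag) ⟩
    ∑ {2 + n} (λ _ → S)                                                    ≡⟨ ∑-const (2 + n) S ⟩
    S + (S + n * S)                                                        ≡⟨ sym (+-assoc S S (n * S)) ⟩
    S + S + n * S                                                          ∎)
    where
    S : ℕ
    S = ∑ (λ x → ∑ (w x))
    rest : Fin (2 + n) → ℕ
    rest z = ∑ (λ x → ∑ (λ y → w (punchIn z x) (punchIn z y)))

  -- Exactly `n !` permutations send two distinct points to a given ordered pair of distinct points.
  -- If one of them is `zero`, its image is the inserted value; otherwise both points remain after
  -- removing `zero`.
  ∑π-pair : ∀ n (w : Fin (2 + n) → Fin (2 + n) → ℕ) → (∀ z → w z z ≡ 0) → ∀ {u v} → u ≢ v →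
    ∑π (2 + n) (λ π → w (π u) (π v)) ≡ n ! * ∑ (λ x → ∑ (w x))
  ∑π-pair n w w-diag {zero}  {zero}  u≢v = contradiction refl u≢v
  ∑π-pair n w w-diag {zero}  {suc v} u≢v = begin
    ∑ (λ z → ∑π (suc n) (λ π → w z (punchIn z (π v))))    ≡⟨ ∑-cong (λ z → ∑π-point n (w z ∘ punchIn z) v) ⟩
    ∑ (λ z → n ! * ∑ (w z ∘ punchIn z))                   ≡⟨ sym (∑-*ˡ (n !) (λ z → ∑ (w z ∘ punchIn z))) ⟩
    n ! * ∑ (λ z → ∑ (w z ∘ punchIn z))
      ≡⟨ cong (n ! *_) (∑-cong (λ z → sym (trans (∑-remove (w z) z) (cong (_+ ∑ (w z ∘ punchIn z)) (w-diag z))))) ⟩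
    n ! * ∑ (λ z → ∑ (w z))                               ∎
  ∑π-pair n w w-diag {suc u} {zero}  u≢v =
    trans (∑π-pair n (flip w) w-diag {zero} {suc u} (u≢v ∘ sym)) (cong (n ! *_) (sym (∑-comm w)))
  ∑π-pair zero w w-diag {suc zero} {suc zero} u≢v = contradiction refl u≢v
  ∑π-pair (suc n) w w-diag {suc u} {suc v} u≢v = begin
    ∑ (λ z → ∑π (2 + n) (λ π → w (punchIn z (π u)) (punchIn z (π v))))
      ≡⟨ ∑-cong (λ z → ∑π-pair n (λ x y → w (punchIn z x) (punchIn z y)) (w-diag ∘ punchIn z) (u≢v ∘ cong suc)) ⟩
    ∑ (λ z → n ! * rest z)                  ≡⟨ sym (∑-*ˡ (n !) rest) ⟩
    n ! * ∑ rest                            ≡⟨ cong (n ! *_) (∑∑∑-punchIn w w-diag) ⟩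
    n ! * (suc n * ∑ (λ x → ∑ (w x)))       ≡⟨ arith (n !) (suc n) _ ⟩
    suc n * n ! * ∑ (λ x → ∑ (w x))         ∎
    where
    rest : Fin (3 + n) → ℕ
    rest z = ∑ (λ x → ∑ (λ y → w (punchIn z x) (punchIn z y)))
    arith : ∀ a b c → a * (b * c) ≡ b * a * c
    arith = solve-∀

common : ∀ {n} (b c : Fin n → Fin n → Bool) → Fin n → Fin n → Bool
common b c u v = b u v ∧ c u v

module _ {N q} (pair : ∀ (w : Fin N → Fin N → ℕ) → (∀ z → w z z ≡ 0) → ∀ {u v} → u ≢ v →
                       ∑π N (λ π → w (π u) (π v)) ≡ q * ∑ (λ x → ∑ (w x)))
         (b c : Fin N → Fin N → Bool) (b-irrefl : ∀ u → b u u ≡ false) (c-irrefl : ∀ u → c u u ≡ false) where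

  private
    X : (Fin N → Fin N) → ℕ
    X π = e2 (common b (λ u v → c (π u) (π v)))

  -- Linearity of expectation: each edge of `b` lands on an edge of `c` under `q * e2 c`
  -- permutations.
  ∑π-common : ∑π N X ≡ q * (e2 b * e2 c)
  ∑π-common = begin
    ∑π N X                                                              ≡⟨ ∑π-∑ N (λ u π → ∑ (λ v → ⟦ b u v ∧ c (π u) (π v) ⟧)) ⟩
    ∑ (λ u → ∑π N (λ π → ∑ (λ v → ⟦ b u v ∧ c (π u) (π v) ⟧)))          ≡⟨ ∑-cong (λ u → ∑π-∑ N (λ v π → ⟦ b u v ∧ c (π u) (π v) ⟧)) ⟩
    ∑ (λ u → ∑ (λ v → ∑π N (λ π → ⟦ b u v ∧ c (π u) (π v) ⟧)))          ≡⟨ ∑-cong (λ u → ∑-cong (term u)) ⟩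
    ∑ (λ u → ∑ (λ v → q * e2 c * ⟦ b u v ⟧))                            ≡⟨ ∑-cong (λ u → sym (∑-*ˡ (q * e2 c) (λ v → ⟦ b u v ⟧))) ⟩
    ∑ (λ u → q * e2 c * cnt (b u))                                      ≡⟨ sym (∑-*ˡ (q * e2 c) (λ u → cnt (b u))) ⟩
    q * e2 c * e2 b                                                     ≡⟨ arith q (e2 c) (e2 b) ⟩
    q * (e2 b * e2 c)                                                   ∎
    where
    open ≡-Reasoning
    arith : ∀ a b c → a * b * c ≡ a * (c * b)
    arith = solve-∀
    term : ∀ u v → ∑π N (λ π → ⟦ b u v ∧ c (π u) (π v) ⟧) ≡ q * e2 c * ⟦ b u v ⟧
    term u v with b u v in buv
    ... | true  = trans (pair (λ x y → ⟦ c x y ⟧) (cong ⟦_⟧ ∘ c-irrefl) (λ { refl → true≢false buv (b-irrefl u) }))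
                        (sym (*-identityʳ _))
    ... | false = trans (∑π-const N 0) (trans (*-zeroʳ (N !)) (sym (*-zeroʳ (q * e2 c))))

  -- e2 b * e2 c / p is the average of X over all permutations.
  ∃-common≤average : ∀ {p} .{{_ : NonZero q}} → N ! ≡ q * p → ∃ λ π → IsPerm π × p * X π ≤ e2 b * e2 c
  ∃-common≤average {p} N!≡ with ∃-below-average N X
  ... | π , perm , bound = π , perm , *-cancelˡ-≤ q (begin
    q * (p * X π)          ≡⟨ sym (*-assoc q p (X π)) ⟩
    q * p * X π            ≡⟨ cong (_* X π) (sym N!≡) ⟩
    N ! * X π              ≤⟨ bound ⟩
    ∑π N X                 ≡⟨ ∑π-common ⟩
    q * (e2 b * e2 c)      ∎)
    where open ≤-Reasoning

-- The averaging bound with `q = n !`, where `N = 2 + n` and `M = 1 + n`, so that `N !` is `n !`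
-- times `N * M`.
∃-small-overlap : ∀ {N M} → N ≡ suc M → .{{NonZero M}} → (b c : Fin N → Fin N → Bool) →
  (∀ u → b u u ≡ false) → (∀ u → c u u ≡ false) →
  ∃ λ π → IsPerm π × N * M * e2 (common b (λ u v → c (π u) (π v))) ≤ e2 b * e2 c
∃-small-overlap {N} {M@(suc n)} refl b c b-irrefl c-irrefl =
  ∃-common≤average {q = n !} (∑π-pair n) b c b-irrefl c-irrefl {p = N * M} {{n !≢0}} (arith N M (n !))
  where
  arith : ∀ a b c → a * (b * c) ≡ c * (a * b)
  arith = solve-∀

-- Packing copies of a graph

isSuc : ∀ {j} → Fin (suc j) → Bool
isSuc zero    = false
isSuc (suc _) = true

coloured : ∀ {j n} → Colouring (suc j) n → Fin n → Fin n → Bool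
coloured c u v = isSuc (col c u v)

isSuc⁻ : ∀ {j} {i : Fin (suc j)} → isSuc i ≡ true → ∃ λ i' → i ≡ suc i'
isSuc⁻ {i = suc i'} _ = i' , refl

module _ {n} (G : Graph n) where

  -- Each non-zero colour class of c is contained in a copy of G, and the copies overlap
  -- in few edges; β bounds the loss per copy.
  record Packing {j} (β : ℕ) (c : Colouring (suc j) n) : Set where
    field
      diagonal : ∀ u → col c u u ≡ zero
      class    : ∀ i → Σ (Fin n → Fin n) λ ρ → Injective _≡_ _≡_ ρ ×
                   (∀ {u v} → col c u v ≡ suc i → Adj G (ρ u) (ρ v))
      size≤    : e2 (coloured c) ≤ j * e2 (adj G)
      size≥    : j * e2 (adj G) ≤ e2 (coloured c) + j * β
  open Packing

  -- A monochromatic copy of `T` through an edge of non-zero colour lies in that colour class, and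
  -- `ρ` would carry it into the `T`-free graph `G`.
  Packing⇒NIM : ∀ {j β h} {c : Colouring (suc j) n} {T : Graph h} → Packing β c → Free T G →
    ∀ {u v} → coloured c u v ≡ true → NIM c T u v
  Packing⇒NIM {c = c} {T} P free {u} {v} cuv = u≢v , no-copy
    where
    u≢v : u ≢ v
    u≢v refl = true≢false cuv (cong isSuc (diagonal P u))
    no-copy : ∀ (M : MonoCopy c T) → ¬ InCopy M u v
    no-copy M (a , b , ab , φa≡u , φb≡v) with isSuc⁻ cuv
    ... | i , cuv≡ with class P i
    ...   | ρ , ρ-inj , ρ-adj = free (ρ ∘ φ M , φ-inj M ∘ ρ-inj , λ s t st →
      ρ-adj (trans (mono M s t st) (trans (sym (mono M a b ab)) (trans (cong₂ (col c) φa≡u φb≡v) cuv≡))))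

-- The new copy receives colour 1, the old non-zero colours are shifted up.
overlay : ∀ {j} → Fin (suc j) → Bool → Fin (suc (suc j))
overlay (suc i) _     = suc (suc i)
overlay zero    true  = suc zero
overlay zero    false = zero

module _ {n j β} (G : Graph n) (c : Colouring (suc j) n) (P : Packing G β c)
         {π : Fin n → Fin n} (perm : IsPerm π) where

  open Packing

  private
    g : ℕ
    g = e2 (adj G)

    new : Fin n → Fin n → Bool
    new u v = adj G (π u) (π v)

    X : ℕ
    X = e2 (common (coloured c) new)

  addCopy : Colouring (suc (suc j)) n
  addCopy = record { col = λ u v → overlay (col c u v) (new u v)
                   ; col-sym = λ u v → cong₂ overlay (col-sym c u v) (adj-sym G (π u) (π v)) }

  inclusion-exclusion : e2 (coloured addCopy) + X ≡ e2 (coloured c) + g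
  inclusion-exclusion = begin
    e2 (coloured addCopy) + X                                              ≡⟨ sym (e2-+ (coloured addCopy) (common (coloured c) new)) ⟩
    ∑ (λ u → ∑ (λ v → ⟦ coloured addCopy u v ⟧ + ⟦ common (coloured c) new u v ⟧))   ≡⟨ ∑-cong (λ u → ∑-cong (pointwise u)) ⟩
    ∑ (λ u → ∑ (λ v → ⟦ coloured c u v ⟧ + ⟦ new u v ⟧))              ≡⟨ e2-+ (coloured c) new ⟩
    e2 (coloured c) + e2 new                                          ≡⟨ cong (e2 (coloured c) +_) e2-new ⟩
    e2 (coloured c) + g                                               ∎
    where
    open ≡-Reasoning
    e2-+ : ∀ (b b' : Fin n → Fin n → Bool) → ∑ (λ u → ∑ (λ v → ⟦ b u v ⟧ + ⟦ b' u v ⟧)) ≡ e2 b + e2 b'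
    e2-+ b b' = trans (∑-cong (λ u → ∑-+ _ _)) (∑-+ _ _)
    pointwise : ∀ u v → ⟦ coloured addCopy u v ⟧ + ⟦ common (coloured c) new u v ⟧ ≡ ⟦ coloured c u v ⟧ + ⟦ new u v ⟧
    pointwise u v with col c u v | new u v
    ... | zero  | true  = refl
    ... | zero  | false = refl
    ... | suc _ | true  = refl
    ... | suc _ | false = refl
    e2-new : e2 new ≡ g
    e2-new = trans (∑-cong (λ u → IsPerm.reindex perm (λ y → ⟦ adj G (π u) y ⟧))) (IsPerm.reindex perm (λ x → cnt (adj G x)))

  diagonal' : ∀ u → col addCopy u u ≡ zero
  diagonal' u rewrite diagonal P u | irrefl G (π u) = refl

  class' : ∀ i → Σ (Fin n → Fin n) λ ρ → Injective _≡_ _≡_ ρ ×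
             (∀ {u v} → col addCopy u v ≡ suc i → Adj G (ρ u) (ρ v))
  class' zero = π , IsPerm.injective perm , λ {u} {v} → first (col c u v) (new u v)
    where
    first : ∀ a b → overlay {j} a b ≡ suc zero → b ≡ true
    first zero true _ = refl
  class' (suc i) with class P i
  ... | ρ , ρ-inj , ρ-adj = ρ , ρ-inj , λ {u} {v} eq → ρ-adj (later (col c u v) (new u v) eq)
    where
    later : ∀ a b → overlay {j} a b ≡ suc (suc i) → a ≡ suc i
    later (suc _) _     eq = suc-injective eq
    later zero    true  ()
    later zero    false ()

  size≤' : e2 (coloured addCopy) ≤ suc j * g
  size≤' = begin
    e2 (coloured addCopy)         ≤⟨ m≤m+n _ X ⟩
    e2 (coloured addCopy) + X     ≡⟨ inclusion-exclusion ⟩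
    e2 (coloured c) + g      ≤⟨ +-monoˡ-≤ g (size≤ P) ⟩
    j * g + g                ≡⟨ +-comm (j * g) g ⟩
    suc j * g                ∎
    where open ≤-Reasoning

  size≥' : X ≤ β → suc j * g ≤ e2 (coloured addCopy) + suc j * β
  size≥' X≤β = begin
    g + j * g                              ≤⟨ +-monoʳ-≤ g (size≥ P) ⟩
    g + (e2 (coloured c) + j * β)          ≡⟨ arith g (e2 (coloured c)) (j * β) ⟩
    (e2 (coloured c) + g) + j * β          ≡⟨ cong (_+ j * β) (sym inclusion-exclusion) ⟩
    (e2 (coloured addCopy) + X) + j * β         ≤⟨ +-monoˡ-≤ (j * β) (+-monoʳ-≤ (e2 (coloured addCopy)) X≤β) ⟩
    (e2 (coloured addCopy) + β) + j * β         ≡⟨ +-assoc (e2 (coloured addCopy)) β (j * β) ⟩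
    e2 (coloured addCopy) + suc j * β           ∎
    where
    open ≤-Reasoning
    arith : ∀ g e b → g + (e + b) ≡ (e + g) + b
    arith = solve-∀

  addCopy-Packing : X ≤ β → Packing G β addCopy
  addCopy-Packing X≤β = record { diagonal = diagonal' ; class = class' ; size≤ = size≤' ; size≥ = size≥' X≤β }

-- Both `e` and `g` are linear in `N`, and `N = M + 1` is at most `2 * M`, so the average overlap is
-- bounded by a constant.
overlap-bound : ∀ {N M K D X e g} → N ≡ suc M → .{{_ : NonZero N}} .{{_ : NonZero M}} →
  N * M * X ≤ e * g → e ≤ K * (D * N) → g ≤ D * N → X ≤ 2 * (K * (D * D))
overlap-bound {N} {M} {K} {D} {X} {e} {g} N≡ few e≤ g≤ = *-cancelˡ-≤ M (*-cancelˡ-≤ N (begin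
  N * (M * X)                        ≡⟨ sym (*-assoc N M X) ⟩
  N * M * X                          ≤⟨ few ⟩
  e * g                              ≤⟨ *-mono-≤ e≤ g≤ ⟩
  K * (D * N) * (D * N)              ≡⟨ arith₁ K D N ⟩
  N * (K * (D * D)) * N              ≡⟨ cong (N * (K * (D * D)) *_) N≡ ⟩
  N * (K * (D * D)) * (1 + M)        ≤⟨ *-monoʳ-≤ (N * (K * (D * D))) (+-monoˡ-≤ M (>-nonZero⁻¹ M)) ⟩
  N * (K * (D * D)) * (M + M)        ≡⟨ arith₂ K D N M ⟩
  N * (M * (2 * (K * (D * D))))      ∎))
  where
  open ≤-Reasoning
  arith₁ : ∀ K D N → K * (D * N) * (D * N) ≡ N * (K * (D * D)) * N
  arith₁ = solve-∀
  arith₂ : ∀ K D N M → N * (K * (D * D)) * (M + M) ≡ N * (M * (2 * (K * (D * D))))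
  arith₂ = solve-∀

module _ {n M} (n≡ : n ≡ suc M) .{{_ : NonZero n}} .{{_ : NonZero M}}
         (G : Graph n) {K D : ℕ} (sparse : e2 (adj G) ≤ D * n) where

  private
    β : ℕ
    β = 2 * (K * (D * D))

  -- Copies are added one at a time at random positions. As at most `K` copies are ever present, the
  -- same `β`, built from `K`, bounds every overlap.
  ∃-Packing : ∀ j → j ≤ K → ∃ (Packing G {j} β)
  ∃-Packing zero _ = record { col = λ _ _ → zero ; col-sym = λ _ _ → refl } , record
    { diagonal = λ _ → refl ; class = λ () ; size≥ = z≤n
    ; size≤ = ≤-reflexive (∑-zero (λ u → ∑-zero (λ v → refl))) }
  ∃-Packing (suc j) j<K with ∃-Packing j (<⇒≤ j<K)
  ... | c , P with ∃-small-overlap n≡ (coloured c) (adj G) (λ u → cong isSuc (Packing.diagonal P u)) (irrefl G)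
  ...   | π , perm , few = addCopy G c P perm , addCopy-Packing G c P perm
    (overlap-bound {K = K} {D} n≡ few (≤-trans (Packing.size≤ P) (*-mono-≤ (<⇒≤ j<K) sparse)) sparse)

-- Combining the two bounds

Adj⇒2≤ : ∀ {h} (T : Graph h) {x y} → Adj T x y → 2 ≤ h
Adj⇒2≤ {suc zero}    T {zero} {zero} xy = contradiction refl (Adj-irrefl T xy)
Adj⇒2≤ {suc (suc h)} T xy = s≤s (s≤s z≤n)

∣-∣≤ : ∀ {m n o} → m ≤ n + o → n ≤ m + o → ∣ m - n ∣ ≤ o
∣-∣≤ {m} {n} {o} m≤ n≤ with ≤-total m n
... | inj₁ m≤n = ≤-trans (≤-reflexive (m≤n⇒∣m-n∣≡n∸m m≤n)) (m≤n+o⇒m∸n≤o n m n≤)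
... | inj₂ n≤m = ≤-trans (≤-reflexive (m≤n⇒∣n-m∣≡n∸m n≤m)) (m≤n+o⇒m∸n≤o m n m≤)

theorem1p13 : (k h : ℕ) → 2 ≤ k →
    Σ ℕ λ C → (T : Graph h) → IsForest T → (k ≡ 2 ⊎ IsTree T) →
    Σ ℕ λ N → (n : ℕ) → N ≤ n → (a e : ℕ) →
    IsNim k n T a → IsEx n T e → ∣ a - (k ∸ 1) * e ∣ ≤ C
-- The threshold `2 + h` yields both `h ≤ n`, for the edgeless case, and `2 ≤ n`, for the packing.
theorem1p13 (suc k) h _ = C , λ T forest cases → 2 + h , λ n N≤n a e → bound T forest cases n N≤n a e
  where
  d slack β C : ℕ
  d = h ∸ 2
  slack = upperSlack k h d
  -- The overlap bound for `k` copies with `D = 2 * d`, since a `T`-free graph has `e2` at most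
  -- `2 * d * n`.
  β = 2 * (k * (2 * d * (2 * d)))
  C = slack + k * β

  bound : (T : Graph h) → IsForest T → suc k ≡ 2 ⊎ IsTree T → ∀ n → 2 + h ≤ n → ∀ a e →
    IsNim (suc k) n T a → IsEx n T e → ∣ a - k * e ∣ ≤ C
  bound T forest cases n N≤n a e isNim@((c , c-count) , _) isEx with IsEx⇒extremal {T = T} isEx
                                     | any? (λ x → any? (λ y → true? (adj T x y)))
  -- An edgeless `T` embeds in every graph on at least `h` vertices, so no extremal graph exists.
  ... | G , G-free , e2G | no edgeless = contradiction
    ((λ t → inject≤ t h≤n) , (λ {s} {t} → inject≤-injective h≤n h≤n s t) , λ x y xy → contradiction (x , y , xy) edgeless) G-free
    where
    h≤n : h ≤ n
    h≤n = ≤-trans (m≤n+m h 2) N≤n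
  -- The inequality is decidable, hence stable, so `NIM` may be taken as decidable both for the
  -- optimal colouring and for the packing.
  ... | G , G-free , e2G | yes (x , y , xy) = decidable-stable (_ ≤? C) λ ¬bound →
    ¬¬-Dec₂ (NIM c T) λ D → ¬¬-Dec₂ (NIM (proj₁ packed) T) λ D' → ¬bound (∣-∣≤ (upper D) (lower D'))
    where
    open ≤-Reasoning
    h≡ : 2 + d ≡ h
    h≡ = m+[n∸m]≡n (Adj⇒2≤ T xy)
    2e≤ : 2 * e ≤ 2 * (d * n)
    2e≤ = ≤-trans (≤-reflexive (sym e2G)) (free⇒e2≤ {T = T} forest (≤-reflexive (sym h≡)) G G-free)

    upper : (∀ u v → Dec (NIM c T u v)) → a ≤ k * e + C
    upper D = *-cancelˡ-≤ 2 (begin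
      2 * a                      ≡⟨ sym (e2-nim {T = T} D c-count) ⟩
      e2 (nim D)                 ≤⟨ UpperBound.upper-bound forest xy c D (IsEx⇒e2≤ {T = T} isEx) (sym h≡) cases 2e≤ ⟩
      -- The slack on the doubled scale is kept whole in `C`, so `2 * C` exceeds it by the summand
      -- added here.
      k * (2 * e) + slack        ≤⟨ m≤m+n _ (slack + 2 * (k * β)) ⟩
      k * (2 * e) + slack + (slack + 2 * (k * β))  ≡⟨ arith k e slack (k * β) ⟩
      2 * (k * e + C)            ∎)
      where
      arith : ∀ k e s b → k * (2 * e) + s + (s + 2 * b) ≡ 2 * (k * e + (s + b))
      arith = solve-∀

    2≤n : 2 ≤ n
    2≤n = ≤-trans (m≤m+n 2 h) N≤n
    n≡ : n ≡ suc (n ∸ 1)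
    n≡ = sym (m+[n∸m]≡n (<⇒≤ 2≤n))

    packed : ∃ (Packing G {k} β)
    packed = ∃-Packing n≡ {{>-nonZero (<⇒≤ 2≤n)}} {{>-nonZero (∸-monoˡ-≤ 1 2≤n)}} G {k} {2 * d} (≤-trans (≤-reflexive e2G) (≤-trans 2e≤ (≤-reflexive (sym (*-assoc 2 d n))))) k ≤-refl

    lower : (∀ u v → Dec (NIM (proj₁ packed) T u v)) → k * e ≤ a + C
    lower D' = *-cancelˡ-≤ 2 (begin
      2 * (k * e)                                ≡⟨ arith₁ k e ⟩
      k * (2 * e)                                ≡⟨ cong (k *_) (sym e2G) ⟩
      k * e2 (adj G)                             ≤⟨ Packing.size≥ (proj₂ packed) ⟩
      e2 (coloured (proj₁ packed)) + k * β       ≤⟨ +-monoˡ-≤ (k * β) (e2-mono (λ uv → nim⁺ {T = T} D' (Packing⇒NIM G (proj₂ packed) G-free uv))) ⟩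
      e2 (nim D') + k * β                        ≤⟨ +-monoˡ-≤ (k * β) (IsNim⇒e2≤ {T = T} D' isNim) ⟩
      2 * a + k * β                              ≤⟨ m≤m+n _ (2 * slack + k * β) ⟩
      2 * a + k * β + (2 * slack + k * β)        ≡⟨ arith₂ a slack (k * β) ⟩
      2 * (a + C)                                ∎)
      where
      arith₁ : ∀ k e → 2 * (k * e) ≡ k * (2 * e)
      arith₁ = solve-∀
      arith₂ : ∀ a s b → 2 * a + b + (2 * s + b) ≡ 2 * (a + (s + b))
      arith₂ = solve-∀
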